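{- Let $n\geq 12$ be an even integer. Among all binary trees on $n$ vertices, the distance between center and centroid is maximized by a crg tree; that is, there is a crg tree $T^*$ on $n$ vertices such that $d_T(C(T),C_d(T))\leq d_{T^*}(C(T^*),C_d(T^*))$ for every binary tree $T$ on $n$ vertices.
   Context: All graphs are finite, simple, connected and undirected. A pendant vertex is a vertex of degree $1$. A binary tree is a tree in which every non-pendant vertex has degree $3$ (so its number of vertices is even). Center and centroid: the eccentricity of $v\in V(T)$ is $e(v)=\max_{u}d_T(u,v)$; the center $C(T)$ is the set of vertices of minimum eccentricity. A branch at $v$ is a maximal subtree of $T$ containing $v$ as a pendant vertex; the weight of $v$ is the maximum number of edges in a branch at $v$; the centroid $C_d(T)$ is the set of vertices of minimum weight. For $X,Y\subseteq V(T)$, $d_T(X,Y)=\min\{d_T(x,y):x\in X,y\in Y\}$. Rooted binary trees: a rooted binary tree is a rooted tree whose root has degree $2$ and in which every other vertex has degree $1$ or $3$; the single-vertex rooted tree is also allowed. The height (level) of a vertex is its distance to the root. A rooted binary tree is ordered if the vertices of each level $l\ge 1$ are linearly ordered so that two vertices at level $l+1$ with different parents are ordered as their parents are at level $l$. A rooted binary tree is rgood if (i) the heights of any two of its pendant vertices differ by at most $1$, and (ii) it can be ordered so that the parents of the pendant vertices at the highest level form a final segment in the ordering of the vertices at the next-to-highest level. For each odd $l$ there is, up to isomorphism, exactly one rgood binary tree on $l$ vertices, denoted $T_{rg}^l$. Crg trees: a binary caterpillar is a binary tree having a path such that every vertex not on the path is adjacent to a vertex of the path. For even $n\ge 4$ and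 odd $l$ with $3\le l<n$, the crg tree $T_{rg}^{n,l}$ is the tree on $n$ vertices obtained by identifying the root of $T_{rg}^l$ with a vertex of maximum eccentricity of a binary caterpillar on $n-l+1$ vertices. -}

module Defs where

open import Data.Bool using (Bool; false; T; _∧_)
open import Data.Fin using (Fin; _<?_)
open import Data.Fin.Subset using (Subset; ⊤; _∈_; _⊆_; ∣_∣; Nonempty)
open import Data.List using (List; []; _∷_)
import Data.List.Membership.Propositional as List
open import Data.List.Relation.Unary.Unique.Propositional using (Unique)
open import Data.Nat using (ℕ; zero; suc; _+_; _∸_; _≤_; _<_; ∣_-_∣)
open import Data.Nat.Divisibility using (_∣_)
open import Data.Product using (∃; ∃-syntax; Σ-syntax; _×_; proj₁)
open import Data.Sum using (_⊎_)
open import Data.Vec using (tabulate; sum)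
open import Function using (_on_; _⇔_)
open import Function.Definitions using (Injective)
open import Level using (0ℓ)
open import Relation.Binary using (Rel; IsStrictTotalOrder)
open import Relation.Binary.PropositionalEquality using (_≡_; _≢_)
open import Relation.Nullary using (¬_)
open import Relation.Nullary.Decidable using (⌊_⌋)

IsMin IsMax : (ℕ → Set) → ℕ → Set
IsMin P m = P m × (∀ k → P k → m ≤ k)
IsMax P m = P m × (∀ k → P k → k ≤ m)

record Graph (n : ℕ) : Set where
  field
    adj    : Fin n → Fin n → Bool
    sym    : ∀ u v → adj u v ≡ adj v u
    irrefl : ∀ v → adj v v ≡ false

  Adj : Fin n → Fin n → Set
  Adj u v = T (adj u v)

  degree : Fin n → ℕ
  degree v = ∣ tabulate (adj v) ∣

  -- Each edge uv is counted once, at its smaller endpoint.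
  edgeCount : ℕ
  edgeCount = sum (tabulate λ u → ∣ tabulate (λ v → ⌊ u <? v ⌋ ∧ adj u v) ∣)

  Pendant : Fin n → Set
  Pendant v = degree v ≡ 1

open Graph public using (Adj; degree; edgeCount; Pendant)

data Walk {n} (G : Graph n) : Fin n → Fin n → ℕ → Set where
  [_] : ∀ v → Walk G v v 0
  _∷_ : ∀ {u v w k} → Adj G u v → Walk G v w k → Walk G u w (suc k)

module _ {n} {G : Graph n} where

  vertices : ∀ {u v k} → Walk G u v k → List (Fin n)
  vertices [ v ]             = v ∷ []
  vertices (_∷_ {u = u} _ p) = u ∷ vertices p

  IsPath : ∀ {u v k} → Walk G u v k → Set
  IsPath p = Unique (vertices p)

module _ {n} (G : Graph n) where

  -- A cycle is a path with at least three vertices whose ends are adjacent.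
  Acyclic : Set
  Acyclic = ∀ {u v k} (p : Walk G u v k) → IsPath p → 2 ≤ k → ¬ Adj G v u

  -- (S, G) is a tree, where S is the vertex set and the edges are those of G;
  -- the elements of Fin n outside S are not vertices.  S = ⊤ for a tree on
  -- all of Fin n, and other S are used for subtrees.
  record IsTreeOn (S : Subset n) : Set where
    field
      nonempty  : Nonempty S
      edgesIn   : ∀ {u v} → Adj G u v → u ∈ S × v ∈ S
      connected : ∀ {u v} → u ∈ S → v ∈ S → ∃[ k ] Walk G u v k
      acyclic   : Acyclic

  IsTree : Set
  IsTree = IsTreeOn ⊤

  IsBinaryTree : Set
  IsBinaryTree = IsTree × (∀ v → ¬ Pendant G v → degree G v ≡ 3)

  IsDist : Fin n → Fin n → ℕ → Set
  IsDist u v = IsMin (Walk G u v)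

  IsEcc : Fin n → ℕ → Set
  IsEcc v = IsMax (λ d → ∃[ u ] IsDist u v d)

  Center : Fin n → Set
  Center v = ∃[ e ] IsEcc v e × (∀ w e′ → IsEcc w e′ → e ≤ e′)

  MaxEccentric : Fin n → Set
  MaxEccentric v = ∃[ e ] IsEcc v e × (∀ w e′ → IsEcc w e′ → e′ ≤ e)

  IsSetDist : (X Y : Fin n → Set) → ℕ → Set
  IsSetDist X Y = IsMin (λ k → ∃[ x ] ∃[ y ] X x × Y y × IsDist x y k)

record Subtree {n} (G : Graph n) : Set where
  field
    support  : Subset n
    graph    : Graph n
    isTree   : IsTreeOn graph support
    subgraph : ∀ {u v} → Adj graph u v → Adj G u v

open Subtree public

module _ {n} {G : Graph n} where

  _⊑_ : Subtree G → Subtree G → Set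
  H ⊑ K = support H ⊆ support K × (∀ {u v} → Adj (graph H) u v → Adj (graph K) u v)

  HasPendant : Fin n → Subtree G → Set
  HasPendant v H = v ∈ support H × Pendant (graph H) v

  IsBranchAt : Fin n → Subtree G → Set
  IsBranchAt v H = HasPendant v H × (∀ K → HasPendant v K → H ⊑ K → K ⊑ H)

module _ {n} (G : Graph n) where

  IsWeight : Fin n → ℕ → Set
  IsWeight v = IsMax (λ k → Σ[ H ∈ Subtree G ] IsBranchAt v H × edgeCount (graph H) ≡ k)

  Centroid : Fin n → Set
  Centroid v = ∃[ k ] IsWeight v k × (∀ w k′ → IsWeight w k′ → k ≤ k′)

  IsCenterCentroidDist : ℕ → Set
  IsCenterCentroidDist = IsSetDist G (Center G) Centroid

  IsBinaryCaterpillar : Set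
  IsBinaryCaterpillar = IsBinaryTree G ×
    (∃[ u ] ∃[ v ] ∃[ k ] Σ[ p ∈ Walk G u v k ] IsPath p ×
      (∀ x → x List.∉ vertices p → ∃[ y ] y List.∈ vertices p × Adj G x y))

module _ {n} (G : Graph n) (r : Fin n) where

  IsRootedBinaryTree : Set
  IsRootedBinaryTree = IsTree G ×
    (n ≡ 1 ⊎
     (degree G r ≡ 2 × (∀ v → v ≢ r → degree G v ≡ 1 ⊎ degree G v ≡ 3)))

  IsHeight : Fin n → ℕ → Set
  IsHeight v = IsDist G v r

  Level : ℕ → Set
  Level h = ∃[ v ] IsHeight v h

  -- p, at height h, is the parent of v.
  IsParent : ℕ → Fin n → Fin n → Set
  IsParent h p v = Adj G p v × IsHeight p h × IsHeight v (suc h)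

  -- Only the restrictions of _≺_ to the single levels h ≥ 1 matter.
  record IsOrdering (_≺_ : Rel (Fin n) 0ℓ) : Set where
    field
      linear     : ∀ h → 1 ≤ h →
                   IsStrictTotalOrder {A = Level h} (_≡_ on proj₁) (_≺_ on proj₁)
      compatible : ∀ h → 1 ≤ h → ∀ {p q u v} →
                   IsParent h p u → IsParent h q v → p ≢ q → (u ≺ v ⇔ p ≺ q)

  HasPendantChild : ℕ → Fin n → Set
  HasPendantChild h p = ∃[ v ] Pendant G v × IsParent h p v

  IsRgood : Set₁
  IsRgood =
    IsRootedBinaryTree ×
    (∀ u v hu hv → Pendant G u → Pendant G v → IsHeight u hu → IsHeight v hv →
      ∣ hu - hv ∣ ≤ 1) ×
    (∃ λ (_≺_ : Rel (Fin n) 0ℓ) → IsOrdering _≺_ ×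
      (∀ h → IsMax Level (suc h) →
        ∀ p q → HasPendantChild h p → IsHeight q h → p ≺ q → HasPendantChild h q))

-- G is, up to isomorphism, the graph obtained from the disjoint union of A and B
-- by identifying a with b; f and g are the resulting inclusions of A and B.
record IsIdentification {l m n} (A : Graph l) (a : Fin l) (B : Graph m) (b : Fin m)
                        (G : Graph n) : Set where
  field
    f       : Fin l → Fin n
    g       : Fin m → Fin n
    f-inj   : Injective _≡_ _≡_ f
    g-inj   : Injective _≡_ _≡_ g
    glued   : f a ≡ g b
    meet    : ∀ i j → f i ≡ g j → i ≡ a × j ≡ b
    cover   : ∀ x → (∃[ i ] f i ≡ x) ⊎ (∃[ j ] g j ≡ x)
    edges   : ∀ x y → Adj G x y ⇔
              ((∃[ i ] ∃[ j ] f i ≡ x × f j ≡ y × Adj A i j) ⊎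
               (∃[ i ] ∃[ j ] g i ≡ x × g j ≡ y × Adj B i j))

IsCrg : ∀ n (l : ℕ) → Graph n → Set₁
IsCrg n l G =
  (2 ∣ n × 4 ≤ n) × (¬ 2 ∣ l × 3 ≤ l × l < n) ×
  (Σ[ R ∈ Graph l ] Σ[ r ∈ Fin l ]
   Σ[ C ∈ Graph (n ∸ l + 1) ] Σ[ c ∈ Fin (n ∸ l + 1) ]
     IsRgood R r × IsBinaryCaterpillar C × MaxEccentric C c ×
     IsIdentification R r C c G)

{-# OPTIONS --safe #-}

-- Let d ≥ 1 be the distance from the centroid to the center of a binary tree on n vertices, and cut the first
-- edge of the path from the centroid to the center.  The side A of the centroid has more vertices than the
-- other side B.  If A has height h, then minimality of the eccentricity at the end of the path yields a vertex
-- of B at distance at least 2d + h from the centroid.  Every level of a binary tree on the way to that vertex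
-- costs two vertices of B, and A has fewer than 2^(h+1) vertices.  Writing n = 2(a + e) with e ≤ a ≤ e + 1, this
-- gives 2d + H ≤ e, where H is the height of the rgood tree on 2a + 1 vertices.
--
-- Conversely, glue that rgood tree, a heap with the vertices 0, …, 2a in which the children of i are 2i + 1 and
-- 2i + 2, to a caterpillar on 2e vertices.  All centroids lie in the heap; and if 2D + H ≤ e, then the spine
-- vertex at depth D has eccentricity at most e − D, so every center has depth at least D in the caterpillar.
module Submission where

open import Defs
open import Data.Bool using (Bool; true; false; T; _∧_; _∨_; if_then_else_)
open import Data.Bool.Properties using (T?; T-∧; T-∨; T-≡)
open import Data.Empty using (⊥; ⊥-elim)
open import Data.Fin using (Fin; zero; suc; toℕ; fromℕ<)
import Data.Fin as Fin
import Data.Fin.Properties as Fin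
open import Data.Fin.Properties using (_≟_; any?; all?)
open import Data.Fin.Subset using (Subset; ∣_∣)
import Data.Fin.Subset as Subset
import Data.Fin.Subset.Properties as Subset
open import Data.List using (List; []; _∷_; length; filter; allFin)
open import Data.List using () renaming (_∷_ to infixr 5 _∷ᵛ_)
import Data.List as List
open import Data.List.Membership.Propositional using (_∈_; _∉_)
open import Data.List.Membership.Propositional.Properties using (∈-filter⁺; ∈-filter⁻; ∈-allFin)
open import Data.List.Membership.Propositional.Properties.WithK using (unique∧set⇒bag)
open import Data.List.Relation.Binary.BagAndSetEquality using (∼bag⇒↭)
open import Data.List.Relation.Binary.Permutation.Propositional.Properties using (↭-length)
open import Data.List.Relation.Unary.All using (All; []; _∷_)
import Data.List.Relation.Unary.All as All
open import Data.List.Relation.Unary.All.Properties using (¬Any⇒All¬; All¬⇒¬Any)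
open import Data.List.Relation.Unary.AllPairs using ([]; _∷_)
open import Data.List.Relation.Unary.Any using (here; there)
open import Data.List.Relation.Unary.Unique.Propositional using (Unique)
import Data.List.Relation.Unary.Unique.Propositional.Properties as Unique
open import Data.Nat hiding (_≟_)
open import Data.Nat.Divisibility using (_∣_; divides)
open import Data.Nat.Induction using (<-wellFounded; Acc; acc)
open import Data.Nat.Properties hiding (_≟_; ≡-irrelevant)
open import Data.Nat.Tactic.RingSolver using (solve)
open import Data.Product using (∃; ∃-syntax; Σ-syntax; Σ; _×_; _,_; proj₁; proj₂)
open import Data.Sum using (_⊎_; inj₁; inj₂; [_,_]′)
open import Data.Vec using (tabulate; sum)
open import Data.Vec.Properties using (lookup∘tabulate; tabulate-cong; lookup⇒[]=; []=⇒lookup)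
open import Function using (_∘_; _⇔_; id; mk⇔; Equivalence; case_of_)
open import Level using (0ℓ)
open import Relation.Binary using (Rel; tri<; tri≈; tri>)
open import Relation.Binary.PropositionalEquality
  using (_≡_; _≢_; refl; sym; trans; cong; cong₂; subst; subst₂; ≢-sym)
open import Relation.Nullary using (¬_; Dec; yes; no)
open import Relation.Nullary.Decidable using (⌊_⌋; toWitness; fromWitness; _×-dec_)
open import Relation.Unary using (Decidable)


-- Both directions meet in the single condition `2D + H ≤ e`: a binary tree with distance `d ≥ 1`
-- satisfies it for `D = d`, and the crg tree has distance at least every `D` that satisfies it. So
-- the maximum itself is never computed. The balance of `a` and `e` is used from both sides. By
-- `e ≤ a` the heap, with `2a + 1` vertices, is more than half of the tree, which traps the
-- centroids in it. By `a ≤ e + 1` the heavier side of an arbitrary tree has at least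
-- `a + e + 1 ≥ 2a` vertices, which forces `h ≥ H`. Parity absorbs the remaining loss: the even
-- number `2(2d + h)` is at most `B + 1 ≤ a + e ≤ 2e + 1`. The definitions speak of walks and
-- maximal subtrees, which are awkward to count with. They are translated into distances: an edge
-- `u v` splits the vertices by which end is nearer, and the branch at `v` through `u` has as many
-- edges as the side of `u` has vertices. The concrete trees are given by parent functions on
-- numbers, so that being a tree is proved once for the heap, the caterpillar and the glued tree.

-- The slack k makes this a certificate for a linear inequality: the equation is a semiring identity.
lin : ∀ {x y a b} k → x ≤ y → a + y + k ≡ b + x → a ≤ b
lin {x} {y} {a} {b} k x≤y eq =
  +-cancelʳ-≤ x a b
    (≤-trans (+-monoʳ-≤ a x≤y) (≤-trans (m≤m+n (a + y) k) (≤-reflexive eq)))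

least : ∀ {P : ℕ → Set} → Decidable P → ∃ P → ∃ (IsMin P)
least {P} P? (k , pk) = go k (<-wellFounded k) pk
  where
  go : ∀ k → Acc _<_ k → P k → ∃ (IsMin P)
  go k (acc rs) pk with anyUpTo? P? k
  ... | yes (j , j<k , pj) = go j (rs j<k) pj
  ... | no ¬p = k , pk , λ j pj → ≮⇒≥ λ j<k → ¬p (j , j<k , pj)

IsMin-unique : ∀ {P : ℕ → Set} {j k} → IsMin P j → IsMin P k → j ≡ k
IsMin-unique (pj , minj) (pk , mink) = ≤-antisym (minj _ pk) (mink _ pj)

IsMax-unique : ∀ {P : ℕ → Set} {j k} → IsMax P j → IsMax P k → j ≡ k
IsMax-unique (pj , maxj) (pk , maxk) = ≤-antisym (maxk _ pj) (maxj _ pk)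

argmax : ∀ {n} → Fin n → (f : Fin n → ℕ) → ∃[ i ] ∀ j → f j ≤ f i
argmax {suc zero} _ f = zero , λ { zero → ≤-refl }
argmax {suc (suc n)} _ f with argmax {suc n} zero (f ∘ suc)
... | i , max with ≤-total (f (suc i)) (f zero)
...   | inj₁ le = zero , λ { zero → ≤-refl ; (suc j) → ≤-trans (max j) le }
...   | inj₂ ge = suc i , λ { zero → ge ; (suc j) → max j }

-- Walks and the extraction of paths from them.

module _ {n} (G : Graph n) where

  walk? : ∀ k u v → Dec (Walk G u v k)
  walk? zero u v with u ≟ v
  ... | yes refl = yes [ u ]
  ... | no u≢v = no λ { [ _ ] → u≢v refl }
  walk? (suc k) u v with any? (λ w → T? (Graph.adj G u w) ×-dec walk? k w v)
  ... | yes (w , a , p) = yes (a ∷ p)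
  ... | no ¬p = no λ { (a ∷ p) → ¬p (_ , a , p) }

  -- Walks inside a set of vertices; with `P` as `_≢ y`, a path extracted from such a walk can be
  -- closed through `y` to a cycle.
  data Reach (P : Fin n → Set) : Fin n → Fin n → Set where
    here : ∀ {u} → P u → Reach P u u
    step : ∀ {u v w} → P u → Adj G u v → Reach P v w → Reach P u w

module _ {n} {G : Graph n} where

  Adj-sym : ∀ {u v} → Adj G u v → Adj G v u
  Adj-sym {u} {v} = subst T (Graph.sym G u v)

  Adj-irrefl : ∀ {v} → ¬ Adj G v v
  Adj-irrefl {v} = subst T (Graph.irrefl G v)

  infixr 5 _++ʷ_

  _++ʷ_ : ∀ {u v w k m} → Walk G u v k → Walk G v w m → Walk G u w (k + m)
  [ _ ] ++ʷ q = q
  (a ∷ p) ++ʷ q = a ∷ (p ++ʷ q)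

  reverseOnto : ∀ {u v w k m} → Walk G u v k → Walk G u w m → Walk G v w (k + m)
  reverseOnto [ _ ] q = q
  reverseOnto {k = suc k} {m} (a ∷ p) q =
    subst (Walk G _ _) (+-suc k m) (reverseOnto p (Adj-sym a ∷ q))

  reverseʷ : ∀ {u v k} → Walk G u v k → Walk G v u k
  reverseʷ {u} {k = k} p = subst (Walk G _ _) (+-identityʳ k) (reverseOnto p [ u ])

  Walk-0 : ∀ {u v} → Walk G u v 0 → u ≡ v
  Walk-0 [ _ ] = refl

  module _ {P : Fin n → Set} where

    Reach-trans : ∀ {u v w} → Reach G P u v → Reach G P v w → Reach G P u w
    Reach-trans (here _) r = r
    Reach-trans (step p a q) r = step p a (Reach-trans q r)

    Reach-sym : ∀ {u v} → Reach G P u v → Reach G P v u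
    Reach-sym (here p) = here p
    Reach-sym (step p a q) = Reach-trans (Reach-sym q) (step (first q) (Adj-sym a) (here p))
      where
      first : ∀ {u v} → Reach G P u v → P u
      first (here p) = p
      first (step p _ _) = p

    Path : Fin n → Fin n → Set
    Path u v = ∃[ k ] Σ[ p ∈ Walk G u v k ] IsPath p × All P (vertices p)

    suffix : ∀ {u v w k} (p : Walk G w v k) → IsPath p → All P (vertices p) →
             u ∈ vertices p → Path u v
    suffix [ w ] ip ps (here refl) = _ , [ w ] , ip , ps
    suffix p@(_ ∷ _) ip ps (here refl) = _ , p , ip , ps
    suffix (a ∷ p) (_ ∷ ip) (_ ∷ ps) (there m) = suffix p ip ps m

    -- Loop erasure: if the new vertex already lies on the path obtained from the tail, that path is
    -- cut back to start there.
    path : ∀ {u v} → Reach G P u v → Path u v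
    path (here pu) = _ , [ _ ] , [] ∷ [] , pu ∷ []
    path {u} (step pu a r) with path r
    ... | k , p , ip , ps with u ∈? vertices p
      where open import Data.List.Membership.DecPropositional (_≟_ {n}) using (_∈?_)
    ...   | yes m = suffix p ip ps m
    ...   | no m = _ , a ∷ p , ¬Any⇒All¬ _ m ∷ ip , pu ∷ ps

-- Distances in a tree and the two sides of an edge.

module Metric {n} (G : Graph n) (tree : IsTree G) where

  private
    connected : ∀ u v → ∃[ k ] Walk G u v k
    connected u v = IsTreeOn.connected tree Subset.∈⊤ Subset.∈⊤

  opaque
    dist : Fin n → Fin n → ℕ
    dist u v = proj₁ (least (λ k → walk? G k u v) (connected u v))

    dist-isDist : ∀ u v → IsDist G u v (dist u v)
    dist-isDist u v = proj₂ (least (λ k → walk? G k u v) (connected u v))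

  dist-walk : ∀ u v → Walk G u v (dist u v)
  dist-walk u v = proj₁ (dist-isDist u v)

  dist-min : ∀ {u v k} → Walk G u v k → dist u v ≤ k
  dist-min = proj₂ (dist-isDist _ _) _

  dist-unique : ∀ {u v k} → IsDist G u v k → k ≡ dist u v
  dist-unique p = IsMin-unique p (dist-isDist _ _)

  dist-refl : ∀ u → dist u u ≡ 0
  dist-refl u = n≤0⇒n≡0 (dist-min [ u ])

  dist-0 : ∀ {u v} → dist u v ≡ 0 → u ≡ v
  dist-0 {u} {v} eq = Walk-0 (subst (Walk G u v) eq (dist-walk u v))

  dist-sym : ∀ u v → dist u v ≡ dist v u
  dist-sym u v = ≤-antisym (dist-min (reverseʷ (dist-walk v u))) (dist-min (reverseʷ (dist-walk u v)))

  dist-triangle : ∀ u v w → dist u w ≤ dist u v + dist v w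
  dist-triangle u v w = dist-min (dist-walk u v ++ʷ dist-walk v w)

  dist-adj : ∀ {u v} r → Adj G u v → dist u r ≤ suc (dist v r)
  dist-adj r a = dist-min (a ∷ dist-walk _ r)

  closer : ∀ {u v k} → dist u v ≡ suc k → ∃[ w ] Adj G u w × dist w v ≡ k
  closer {u} {v} {k} eq with subst (Walk G u v) eq (dist-walk u v)
  ... | _∷_ {v = w} a p =
    w , a , ≤-antisym (dist-min p) (s≤s⁻¹ (subst (_≤ suc (dist w v)) eq (dist-adj v a)))

  -- Along a shortest walk from `a` to `r`, every vertex after the first is strictly nearer to `r`
  -- than `y` is, hence differs from `y`.
  descend : ∀ {y r} k {a} → dist a r ≡ k → k ≤ dist y r → a ≢ y → Reach G (_≢ y) a r
  descend {y} {r} zero {a} eq le a≢y = subst (Reach G (_≢ y) a) (dist-0 eq) (here a≢y)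
  descend {y} {r} (suc k) eq le a≢y with closer eq
  ... | w , a , eq′ =
    step a≢y a (descend k eq′ (<⇒≤ le) λ { refl → 1+n≰n (subst (suc k ≤_) eq′ le) })

  -- Otherwise shortest walks from a and from b to r, neither of which meets y, would close a cycle through y.
  unique-parent : ∀ {y a b r} → Adj G y a → Adj G y b →
                  dist a r ≤ dist y r → dist b r ≤ dist y r → a ≡ b
  unique-parent {y} {a} {b} {r} ya yb a≤ b≤ with a ≟ b
  ... | yes a≡b = a≡b
  ... | no a≢b = ⊥-elim (go (path (Reach-trans (descend _ refl a≤ (distinct ya))
                                               (Reach-sym (descend _ refl b≤ (distinct yb))))))
    where
    distinct : ∀ {x} → Adj G y x → x ≢ y
    distinct yx refl = Adj-irrefl {G = G} yx
    go : Path {P = _≢ y} a b → ⊥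
    go (zero , p , _ , _) = a≢b (Walk-0 p)
    go (suc k , p , ip , ps) =
      IsTreeOn.acyclic tree (ya ∷ p) (All.map ≢-sym ps ∷ ip) (s≤s (s≤s z≤n)) (Adj-sym {G = G} yb)

  -- A tie is impossible: at distance 0 both ends would be `r`, and otherwise `unique-parent` would
  -- identify `v` with the neighbour of `u` that is nearer to `r`.
  edge-dist : ∀ {u v} r → Adj G u v → dist u r ≡ suc (dist v r) ⊎ dist v r ≡ suc (dist u r)
  edge-dist {u} {v} r a with <-cmp (dist u r) (dist v r)
  ... | tri< lt _ _ = inj₂ (≤-antisym (dist-adj r (Adj-sym {G = G} a)) lt)
  ... | tri> _ _ gt = inj₁ (≤-antisym (dist-adj r a) gt)
  ... | tri≈ _ eq _ = ⊥-elim (go (dist u r) refl)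
    where
    go : ∀ k → dist u r ≡ k → ⊥
    go zero e = Adj-irrefl {G = G}
      (subst (Adj G u) (trans (dist-0 (trans (sym eq) e)) (sym (dist-0 e))) a)
    go (suc k) e with closer e
    ... | w , uw , e′ with unique-parent a uw (≤-reflexive (sym eq)) (subst₂ _≤_ (sym e′) (sym e) (n≤1+n k))
    ...   | refl = 1+n≢n (trans (sym e) (trans eq e′))

  -- For an edge `u v` this is the component of `u` after the edge is removed.
  Side : Fin n → Fin n → Fin n → Set
  Side u v x = dist u x < dist v x

  side-split : ∀ {u v} x → Adj G u v → Side u v x ⊎ Side v u x
  side-split x a with edge-dist x a
  ... | inj₁ eq = inj₂ (≤-reflexive (sym eq))
  ... | inj₂ eq = inj₁ (≤-reflexive (sym eq))

  side-dist : ∀ {u v x} → Adj G u v → Side u v x → dist v x ≡ suc (dist u x)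
  side-dist a s = ≤-antisym (dist-adj _ (Adj-sym {G = G} a)) s

  side-self : ∀ {u v} → Adj G u v → Side u v u
  side-self {u} {v} a = subst (_< dist v u) (sym (dist-refl u))
    (n≢0⇒n>0 λ eq → Adj-irrefl {G = G} (subst (Adj G u) (dist-0 eq) a))

  adj-dist : ∀ {u v} → Adj G u v → dist u v ≡ 1
  adj-dist {u} {v} a = trans (side-dist (Adj-sym {G = G} a) (side-self (Adj-sym {G = G} a))) (cong suc (dist-refl v))

  side-disjoint : ∀ {u c c′ x} → Adj G u c → Adj G u c′ → Side c u x → Side c′ u x → c ≡ c′
  side-disjoint a a′ s s′ = unique-parent a a′ (<⇒≤ s) (<⇒≤ s′)

  side-child : ∀ {u v x} → Adj G u v → Side u v x → x ≢ u →
               ∃[ c ] Adj G u c × c ≢ v × dist u x ≡ suc (dist c x)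
  side-child {u} {v} {x} a s x≢u with dist u x in eq
  ... | zero = ⊥-elim (x≢u (sym (dist-0 eq)))
  ... | suc k with closer eq
  ...   | c , uc , e = c , uc , (λ { refl → <⇒≱ s (≤-trans (≤-reflexive e) (n≤1+n k)) }) , cong suc (sym e)

  side-extend : ∀ {u v c x} → Adj G u v → Adj G u c → c ≢ v → Side c u x → Side u v x
  side-extend {x = x} a a′ c≢v s with side-split x a
  ... | inj₁ s′ = s′
  ... | inj₂ s′ = ⊥-elim (c≢v (side-disjoint a′ a s s′))

  -- The distances `dist u a` and `dist v b` must agree. If they were positive, `a` and the
  -- neighbour `c` of `b` towards `v` would both be no farther from `u` than `b`, so `unique-parent`
  -- makes them equal, against the distance of `a` from `v`.
  cross-edge : ∀ {u v a b} → Adj G u v → Adj G a b → Side u v a → Side v u b → a ≡ u × b ≡ v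
  cross-edge {u} {v} {a} {b} uv ab sa sb = go (dist u a) refl
    where
    vu = Adj-sym {G = G} uv
    da : dist v a ≡ suc (dist u a)
    da = side-dist uv sa
    db : dist u b ≡ suc (dist v b)
    db = side-dist vu sb
    du : dist u b ≤ suc (dist u a)
    du = subst₂ _≤_ (dist-sym b u) (cong suc (dist-sym a u)) (dist-adj u (Adj-sym {G = G} ab))
    dv : dist v a ≤ suc (dist v b)
    dv = subst₂ _≤_ (dist-sym a v) (cong suc (dist-sym b v)) (dist-adj v ab)
    ba : dist v b ≡ dist u a
    ba = ≤-antisym (s≤s⁻¹ (subst (_≤ suc (dist u a)) db du)) (s≤s⁻¹ (subst (_≤ suc (dist v b)) da dv))
    go : ∀ k → dist u a ≡ k → a ≡ u × b ≡ v
    go zero e = sym (dist-0 e) , sym (dist-0 (trans ba e))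
    go (suc k) e with closer {b} {v} (trans (dist-sym b v) (trans ba e))
    ... | c , bc , ec = ⊥-elim (1+n≰n (≤-trans (≤-reflexive (trans (sym (cong suc e)) (trans (sym da) (trans (dist-sym v a) ac)))) (n≤1+n k)))
      where
      uc : dist c u ≤ dist b u
      uc = ≤-trans (dist-triangle c v u) (≤-trans (≤-reflexive (trans (cong₂ _+_ ec (adj-dist vu)) (+-comm k 1)))
             (≤-trans (≤-reflexive (trans (sym e) (sym ba))) (≤-trans (n≤1+n _) (≤-reflexive (trans (sym db) (dist-sym u b))))))
      ua : dist a u ≤ dist b u
      ua = subst₂ _≤_ (dist-sym u a) (trans (cong suc (sym ba)) (trans (sym db) (dist-sym u b))) (n≤1+n _)
      ac : dist a v ≡ k
      ac = trans (cong (λ z → dist z v) (unique-parent (Adj-sym {G = G} ab) bc ua uc)) ec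

  -- By `cross-edge` a step that changes sides goes along `u v` itself, and what follows it is a
  -- walk from `v`.
  crossing-walk : ∀ {u v x y k} → Adj G u v → Walk G x y k → Side u v x → Side v u y →
                  dist x u + suc (dist v y) ≤ k
  crossing-walk uv [ _ ] sx sy = ⊥-elim (<-asym sx sy)
  crossing-walk {u} {v} {x} {y} uv (_∷_ {v = x′} {k = k} a p) sx sy with side-split x′ uv
  ... | inj₁ sx′ = ≤-trans (+-monoˡ-≤ _ (dist-adj u a)) (s≤s (crossing-walk uv p sx′ sy))
  ... | inj₂ sx′ with cross-edge uv a sx sx′
  ...   | refl , refl rewrite dist-refl u = s≤s (dist-min p)

  crossing : ∀ {u v x y} → Adj G u v → Side u v x → Side v u y → dist x u + suc (dist v y) ≤ dist x y
  crossing uv = crossing-walk uv (dist-walk _ _)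

-- Counting vertices, neighbours and edges.

bit : Bool → ℕ
bit true = 1
bit false = 0

elements : ∀ {n} → (Fin n → Bool) → List (Fin n)
elements f = filter (T? ∘ f) (allFin _)

opaque
  Σᶠ : ∀ {n} → (Fin n → ℕ) → ℕ
  Σᶠ f = sum (tabulate f)

  Σᶠ-cong : ∀ {n} {f g : Fin n → ℕ} → (∀ i → f i ≡ g i) → Σᶠ f ≡ Σᶠ g
  Σᶠ-cong eq = cong sum (tabulate-cong eq)

  Σᶠ-mono : ∀ {n} {f g : Fin n → ℕ} → (∀ i → f i ≤ g i) → Σᶠ f ≤ Σᶠ g
  Σᶠ-mono {zero} le = z≤n
  Σᶠ-mono {suc n} le = +-mono-≤ (le zero) (Σᶠ-mono (le ∘ suc))

  Σᶠ-+ : ∀ {n} (f g : Fin n → ℕ) → Σᶠ (λ i → f i + g i) ≡ Σᶠ f + Σᶠ g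
  Σᶠ-+ {zero} f g = refl
  Σᶠ-+ {suc n} f g = trans (cong (f zero + g zero +_) (Σᶠ-+ (f ∘ suc) (g ∘ suc)))
                           (exchange (f zero) (g zero) _ _)
    where
    exchange : ∀ a b c d → a + b + (c + d) ≡ a + c + (b + d)
    exchange a b c d = solve (a ∷ᵛ b ∷ᵛ c ∷ᵛ d ∷ᵛ [])

  Σᶠ-0 : ∀ n → Σᶠ {n} (λ _ → 0) ≡ 0
  Σᶠ-0 zero = refl
  Σᶠ-0 (suc n) = Σᶠ-0 n

  Σᶠ-swap : ∀ {m n} (f : Fin m → Fin n → ℕ) → Σᶠ (λ i → Σᶠ (f i)) ≡ Σᶠ (λ j → Σᶠ λ i → f i j)
  Σᶠ-swap {zero} {n} f = sym (Σᶠ-0 n)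
  Σᶠ-swap {suc m} f = trans (cong (Σᶠ (f zero) +_) (Σᶠ-swap (f ∘ suc)))
                            (sym (Σᶠ-+ (f zero) _))

  -- There are two ways to evaluate it: as a sum, for inequalities and double counting, and as the
  -- length of a list, for exact values from a duplicate-free enumeration.
  count : ∀ {n} → (Fin n → Bool) → ℕ
  count f = ∣ tabulate f ∣

  count-Σᶠ : ∀ {n} (f : Fin n → Bool) → count f ≡ Σᶠ (bit ∘ f)
  count-Σᶠ {zero} f = refl
  count-Σᶠ {suc n} f with f zero
  ... | true = cong suc (count-Σᶠ (f ∘ suc))
  ... | false = count-Σᶠ (f ∘ suc)

  length-elements : ∀ {n} (f : Fin n → Bool) → length (elements f) ≡ count f
  length-elements {n} f = go n id
    where
    go : ∀ m (g : Fin m → Fin n) → length (filter (T? ∘ f) (List.tabulate g)) ≡ count (f ∘ g)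
    go zero g = refl
    go (suc m) g with f (g zero)
    ... | true = cong suc (go m (g ∘ suc))
    ... | false = go m (g ∘ suc)

  count-true : ∀ n → count {n} (λ _ → true) ≡ n
  count-true zero = refl
  count-true (suc n) = cong suc (count-true n)

  count-none : ∀ n → count {n} (λ _ → false) ≡ 0
  count-none zero = refl
  count-none (suc n) = count-none n

  count-below : ∀ {n} k → k ≤ n → count {n} (λ i → toℕ i <ᵇ k) ≡ k
  count-below {n} zero _ = count-none n
  count-below {suc n} (suc k) (s≤s k≤n) = cong suc (count-below k k≤n)

  degree-count : ∀ {n} (G : Graph n) v → degree G v ≡ count (Graph.adj G v)
  degree-count G v = refl

  edgeCount-Σᶠ : ∀ {n} (G : Graph n) → edgeCount G ≡ Σᶠ λ u → count λ v → ⌊ u Fin.<? v ⌋ ∧ Graph.adj G u v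
  edgeCount-Σᶠ G = refl

bit-T : ∀ {b} → T b → bit b ≡ 1
bit-T {true} _ = refl

bit-¬T : ∀ {b} → ¬ T b → bit b ≡ 0
bit-¬T {false} _ = refl
bit-¬T {true} ¬t = ⊥-elim (¬t _)

bit-cover : ∀ a b c → (T a → T b ⊎ T c) → bit a ≤ bit b + bit c
bit-cover false b c h = z≤n
bit-cover true true c h = s≤s z≤n
bit-cover true false true h = s≤s z≤n
bit-cover true false false h = [ ⊥-elim , ⊥-elim ]′ (h _)

bit-disjoint : ∀ a b c → (T b → T a) → (T c → T a) → (T b → T c → ⊥) → bit b + bit c ≤ bit a
bit-disjoint a true true ba ca bc = ⊥-elim (bc _ _)
bit-disjoint true true false ba ca bc = ≤-refl
bit-disjoint false true false ba ca bc = ⊥-elim (ba _)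
bit-disjoint true false true ba ca bc = ≤-refl
bit-disjoint false false true ba ca bc = ⊥-elim (ca _)
bit-disjoint a false false ba ca bc = z≤n

bit-split : ∀ a b c → (T a → T b ⊎ T c) → (T b → T a) → (T c → T a) → (T b → T c → ⊥) →
            bit a ≡ bit b + bit c
bit-split a b c h ba ca bc = ≤-antisym (bit-cover a b c h) (bit-disjoint a b c ba ca bc)

module _ {n} {f g h : Fin n → Bool} where

  private
    Σ-pair : Σᶠ (λ i → bit (g i) + bit (h i)) ≡ count g + count h
    Σ-pair = trans (Σᶠ-+ _ _) (cong₂ _+_ (sym (count-Σᶠ g)) (sym (count-Σᶠ h)))

  count-cover : (∀ i → T (f i) → T (g i) ⊎ T (h i)) → count f ≤ count g + count h
  count-cover c = subst₂ _≤_ (sym (count-Σᶠ f)) Σ-pair (Σᶠ-mono λ i → bit-cover (f i) (g i) (h i) (c i))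

  count-disjoint : (∀ i → T (g i) → T (f i)) → (∀ i → T (h i) → T (f i)) →
                   (∀ i → T (g i) → T (h i) → ⊥) → count g + count h ≤ count f
  count-disjoint gf hf gh = subst₂ _≤_ Σ-pair (sym (count-Σᶠ f))
    (Σᶠ-mono λ i → bit-disjoint (f i) (g i) (h i) (gf i) (hf i) (gh i))

elements-unique : ∀ {n} (f : Fin n → Bool) → Unique (elements f)
elements-unique f = Unique.filter⁺ (T? ∘ f) (Unique.allFin⁺ _)

∈-elements⁺ : ∀ {n} (f : Fin n → Bool) {i} → T (f i) → i ∈ elements f
∈-elements⁺ f t = ∈-filter⁺ (T? ∘ f) (∈-allFin _) t

∈-elements⁻ : ∀ {n} (f : Fin n → Bool) {i} → i ∈ elements f → T (f i)
∈-elements⁻ f m = proj₂ (∈-filter⁻ (T? ∘ f) {xs = allFin _} m)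

Unique-length : ∀ {A : Set} {xs ys : List A} → Unique xs → Unique ys → (∀ {x} → x ∈ xs ⇔ x ∈ ys) →
                length xs ≡ length ys
Unique-length u u′ eq = ↭-length (∼bag⇒↭ (unique∧set⇒bag u u′ eq))

count-list : ∀ {n} (f : Fin n → Bool) {xs} → Unique xs → (∀ i → T (f i) ⇔ i ∈ xs) →
             count f ≡ length xs
count-list f {xs} u eq = trans (sym (length-elements f))
  (Unique-length (elements-unique f) u (λ {i} →
    mk⇔ (Equivalence.to (eq i) ∘ ∈-elements⁻ f) (∈-elements⁺ f ∘ Equivalence.from (eq i))))

count-single : ∀ {n} (i : Fin n) → count (λ j → ⌊ j ≟ i ⌋) ≡ 1
count-single i = count-list _ ([] ∷ []) λ j →
  mk⇔ (λ t → here (toWitness t)) λ { (here eq) → fromWitness eq }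

count-mono : ∀ {n} {f g : Fin n → Bool} → (∀ i → T (f i) → T (g i)) → count f ≤ count g
count-mono {f = f} {g} fg = subst₂ _≤_ (sym (count-Σᶠ f)) (sym (count-Σᶠ g)) (Σᶠ-mono λ i →
  ≤-trans (bit-cover (f i) (g i) false (inj₁ ∘ fg i)) (≤-reflexive (+-identityʳ _)))

count-⇔ : ∀ {n} {f g : Fin n → Bool} → (∀ i → T (f i) → T (g i)) → (∀ i → T (g i) → T (f i)) →
          count f ≡ count g
count-⇔ fg gf = ≤-antisym (count-mono fg) (count-mono gf)

module _ {n} (G : Graph n) where

  only-neighbour : ∀ {u v} → degree G u ≡ 1 → Adj G u v → ∀ {w} → Adj G u w → w ≡ v
  only-neighbour {u} {v} deg uv {w} uw
    with elements (Graph.adj G u) | trans (length-elements (Graph.adj G u)) (sym (degree-count G u))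
       | ∈-elements⁺ (Graph.adj G u) uv | ∈-elements⁺ (Graph.adj G u) uw
  ... | [] | _ | () | _
  ... | _ ∷ [] | _ | here refl | here refl = refl
  ... | _ ∷ _ ∷ _ | len | _ | _ with trans len deg
  ...   | ()

  record OtherTwo (u v : Fin n) : Set where
    constructor otherTwo
    field
      c₁ c₂ : Fin n
      adj₁ : Adj G u c₁
      adj₂ : Adj G u c₂
      c₁≢v : c₁ ≢ v
      c₂≢v : c₂ ≢ v
      c₁≢c₂ : c₁ ≢ c₂
      all : ∀ {w} → Adj G u w → w ≢ v → w ≡ c₁ ⊎ w ≡ c₂

  other-two : ∀ {u v} → degree G u ≡ 3 → Adj G u v → OtherTwo u v
  other-two {u} {v} deg uv =
    go (elements f) (elements-unique f) (∈-elements⁺ f) (∈-elements⁻ f)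
       (trans (length-elements f) (trans (sym (degree-count G u)) deg)) (∈-elements⁺ f uv)
    where
    f = Graph.adj G u
    go : (xs : List (Fin n)) → Unique xs → (∀ {i} → Adj G u i → i ∈ xs) → (∀ {i} → i ∈ xs → Adj G u i) →
         length xs ≡ 3 → v ∈ xs → OtherTwo u v
    go (a ∷ b ∷ c ∷ []) ((ab ∷ ac ∷ []) ∷ (bc ∷ []) ∷ [] ∷ []) to from _ (here refl) =
      otherTwo b c (from (there (here refl))) (from (there (there (here refl)))) (≢-sym ab) (≢-sym ac) bc
        λ t ne → case to t of λ where
          (here e) → ⊥-elim (ne e)
          (there (here e)) → inj₁ e
          (there (there (here e))) → inj₂ e
    go (a ∷ b ∷ c ∷ []) ((ab ∷ ac ∷ []) ∷ (bc ∷ []) ∷ [] ∷ []) to from _ (there (here refl)) =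
      otherTwo a c (from (here refl)) (from (there (there (here refl)))) ab (≢-sym bc) ac
        λ t ne → case to t of λ where
          (here e) → inj₁ e
          (there (here e)) → ⊥-elim (ne e)
          (there (there (here e))) → inj₂ e
    go (a ∷ b ∷ c ∷ []) ((ab ∷ ac ∷ []) ∷ (bc ∷ []) ∷ [] ∷ []) to from _ (there (there (here refl))) =
      otherTwo a b (from (here refl)) (from (there (here refl))) ac bc ab
        λ t ne → case to t of λ where
          (here e) → inj₁ e
          (there (here e)) → inj₂ e
          (there (there (here e))) → ⊥-elim (ne e)

∧ˡ : ∀ x {y} → T (x ∧ y) → T x
∧ˡ x t = proj₁ (Equivalence.to (T-∧ {x}) t)

∧ʳ : ∀ x {y} → T (x ∧ y) → T y
∧ʳ x t = proj₂ (Equivalence.to (T-∧ {x}) t)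

∧⁺ : ∀ {x y} → T x → T y → T (x ∧ y)
∧⁺ s t = Equivalence.from T-∧ (s , t)

-- Every edge lies in exactly one of P and its converse; the edges are then counted by the vertices they leave.
edgeCount-orientation : ∀ {n} (G : Graph n) (P : Fin n → Fin n → Bool) (q : Fin n → Bool) →
  (∀ i j → Adj G i j → T (P i j) ⊎ T (P j i)) → (∀ i j → T (P i j) → Adj G i j) →
  (∀ i j → T (P i j) → T (P j i) → ⊥) → (∀ i → count (P i) ≡ bit (q i)) →
  edgeCount G ≡ count q
edgeCount-orientation {n} G P q split P⇒adj asym out =
  trans (edgeCount-Σᶠ G) (trans (Σᶠ-cong λ i → trans (count-Σᶠ _) (trans (Σᶠ-cong (pointwise i)) (Σᶠ-+ _ _)))
    (trans (Σᶠ-+ _ _)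
      -- Exchanging the indices in the backward half makes both halves count pairs in `P`, once for
      -- each order of the two numbers.
      (trans (cong (Σᶠ (λ i → Σᶠ (λ j → bit (⌊ i Fin.<? j ⌋ ∧ P i j))) +_) (Σᶠ-swap (λ i j → bit (⌊ i Fin.<? j ⌋ ∧ P j i))))
        (trans (sym (Σᶠ-+ _ _))
          (trans (Σᶠ-cong λ i → trans (sym (Σᶠ-+ _ _)) (trans (Σᶠ-cong (merge i)) (sym (count-Σᶠ (P i)))))
            (trans (Σᶠ-cong out) (sym (count-Σᶠ q))))))))
  where
  pointwise : ∀ i j → bit (⌊ i Fin.<? j ⌋ ∧ Graph.adj G i j)
                      ≡ bit (⌊ i Fin.<? j ⌋ ∧ P i j) + bit (⌊ i Fin.<? j ⌋ ∧ P j i)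
  pointwise i j = bit-split _ _ _
    (λ t → [ inj₁ ∘ ∧⁺ (∧ˡ ⌊ i Fin.<? j ⌋ t) , inj₂ ∘ ∧⁺ (∧ˡ ⌊ i Fin.<? j ⌋ t) ]′ (split i j (∧ʳ ⌊ i Fin.<? j ⌋ t)))
    (λ t → ∧⁺ (∧ˡ ⌊ i Fin.<? j ⌋ t) (P⇒adj i j (∧ʳ ⌊ i Fin.<? j ⌋ t)))
    (λ t → ∧⁺ (∧ˡ ⌊ i Fin.<? j ⌋ t) (Adj-sym {G = G} (P⇒adj j i (∧ʳ ⌊ i Fin.<? j ⌋ t))))
    (λ t t′ → asym i j (∧ʳ ⌊ i Fin.<? j ⌋ t) (∧ʳ ⌊ i Fin.<? j ⌋ t′))
  merge : ∀ i j → bit (⌊ i Fin.<? j ⌋ ∧ P i j) + bit (⌊ j Fin.<? i ⌋ ∧ P i j) ≡ bit (P i j)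
  merge i j = sym (bit-split (P i j) _ _ cmp (∧ʳ ⌊ i Fin.<? j ⌋) (∧ʳ ⌊ j Fin.<? i ⌋)
    λ t t′ → <-asym (toWitness (∧ˡ ⌊ i Fin.<? j ⌋ t)) (toWitness (∧ˡ ⌊ j Fin.<? i ⌋ t′)))
    where
    cmp : T (P i j) → T (⌊ i Fin.<? j ⌋ ∧ P i j) ⊎ T (⌊ j Fin.<? i ⌋ ∧ P i j)
    cmp t with Fin.<-cmp i j
    ... | tri< lt _ _ = inj₁ (∧⁺ (fromWitness lt) t)
    ... | tri> _ _ gt = inj₂ (∧⁺ (fromWitness gt) t)
    ... | tri≈ _ refl _ = ⊥-elim (asym i i t t)

subgraph-acyclic : ∀ {n} {G H : Graph n} → (∀ {u v} → Adj H u v → Adj G u v) → Acyclic G → Acyclic H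
subgraph-acyclic {G = G} {H} sub acyclic p ip 2≤k a =
  acyclic (mapʷ p) (subst Unique (sym (vertices-map p)) ip) 2≤k (sub a)
  where
  mapʷ : ∀ {u v k} → Walk H u v k → Walk G u v k
  mapʷ [ v ] = [ v ]
  mapʷ (a ∷ p) = sub a ∷ mapʷ p
  vertices-map : ∀ {u v k} (p : Walk H u v k) → vertices (mapʷ p) ≡ vertices p
  vertices-map [ v ] = refl
  vertices-map (a ∷ p) = cong (_ ∷_) (vertices-map p)

pendant-neighbour : ∀ {n} (G : Graph n) {v} → Pendant G v → ∃[ u ] Adj G v u
pendant-neighbour G {v} deg
  with elements (Graph.adj G v) | trans (length-elements (Graph.adj G v)) (trans (sym (degree-count G v)) deg)
     | (λ {i} → ∈-elements⁻ (Graph.adj G v) {i})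
... | u ∷ [] | _ | from = u , from (here refl)

∈-tabulate⁺ : ∀ {n} (f : Fin n → Bool) {x} → T (f x) → x Subset.∈ tabulate f
∈-tabulate⁺ f {x} t = lookup⇒[]= x _ (trans (lookup∘tabulate f x) (Equivalence.to T-≡ t))

∈-tabulate⁻ : ∀ {n} (f : Fin n → Bool) {x} → x Subset.∈ tabulate f → T (f x)
∈-tabulate⁻ f {x} m = Equivalence.from T-≡ (trans (sym (lookup∘tabulate f x)) ([]=⇒lookup m))

-- Branches at a vertex as sides of its edges.

module Branch {n} (G : Graph n) (tree : IsTree G) where

  open Metric G tree

  side : Fin n → Fin n → Fin n → Bool
  side u v x = ⌊ dist u x <? dist v x ⌋

  size : Fin n → Fin n → ℕ
  size u v = count (side u v)

  side⁺ : ∀ {u v x} → Side u v x → T (side u v x)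
  side⁺ = fromWitness

  side⁻ : ∀ {u v x} → T (side u v x) → Side u v x
  side⁻ = toWitness

  size-sum : ∀ {u v} → Adj G u v → size u v + size v u ≡ n
  size-sum {u} {v} a = trans
    (≤-antisym
      (count-disjoint {f = λ _ → true} _ _ λ i s t → <-asym (side⁻ {u} {v} s) (side⁻ {v} {u} t))
      (count-cover {f = λ _ → true} λ i _ → [ inj₁ ∘ side⁺ , inj₂ ∘ side⁺ ]′ (side-split i a)))
    (count-true n)

  module _ {u v : Fin n} (uv : Adj G u v) where

    private
      vu : Adj G v u
      vu = Adj-sym {G = G} uv

      -- The vertex set of the branch at `v` through `u`: the side of `u` with `v` attached as a
      -- pendant vertex.
      Member : Fin n → Set
      Member x = x ≡ v ⊎ Side u v x

      member : Fin n → Bool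
      member x = ⌊ x ≟ v ⌋ ∨ side u v x

      member⁺ : ∀ {x} → Member x → T (member x)
      member⁺ {x} (inj₁ e) = Equivalence.from (T-∨ {⌊ x ≟ v ⌋}) (inj₁ (fromWitness e))
      member⁺ {x} (inj₂ s) = Equivalence.from (T-∨ {⌊ x ≟ v ⌋}) (inj₂ (side⁺ s))

      member⁻ : ∀ {x} → T (member x) → Member x
      member⁻ {x} t with Equivalence.to (T-∨ {⌊ x ≟ v ⌋}) t
      ... | inj₁ t = inj₁ (toWitness t)
      ... | inj₂ t = inj₂ (side⁻ t)

      adjᵇ : Fin n → Fin n → Bool
      adjᵇ i j = (member i ∧ member j) ∧ Graph.adj G i j

      adjᵇ⁺ : ∀ {i j} → Member i → Member j → Adj G i j → T (adjᵇ i j)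
      adjᵇ⁺ mi mj a = ∧⁺ (∧⁺ (member⁺ mi) (member⁺ mj)) a

      adjᵇ⁻ : ∀ {i j} → T (adjᵇ i j) → Member i × Member j × Adj G i j
      adjᵇ⁻ {i} {j} t = member⁻ (∧ˡ (member i) (∧ˡ (member i ∧ member j) t)) ,
        member⁻ (∧ʳ (member i) (∧ˡ (member i ∧ member j) t)) , ∧ʳ (member i ∧ member j) t

      adjᵇ-sym : ∀ i j → adjᵇ i j ≡ adjᵇ j i
      adjᵇ-sym i j = cong₂ _∧_ (∧-comm (member i) (member j)) (Graph.sym G i j)
        where open import Data.Bool.Properties using (∧-comm)

      adjᵇ-irrefl : ∀ i → adjᵇ i i ≡ false
      adjᵇ-irrefl i = trans (cong ((member i ∧ member i) ∧_) (Graph.irrefl G i)) (∧-zeroʳ _)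
        where open import Data.Bool.Properties using (∧-zeroʳ)

      B : Graph n
      B = record { adj = adjᵇ ; sym = adjᵇ-sym ; irrefl = adjᵇ-irrefl }

      v-member : Member v
      v-member = inj₁ refl

      u-member : Member u
      u-member = inj₂ (side-self uv)

      ¬Side-v : ¬ Side u v v
      ¬Side-v s = <-asym s (side-self vu)

      neighbour-of-v : ∀ {x} → Adj B v x → x ≡ u
      neighbour-of-v a with adjᵇ⁻ a
      ... | _ , inj₁ refl , a′ = ⊥-elim (Adj-irrefl {G = G} a′)
      ... | _ , inj₂ s , a′ = proj₂ (cross-edge vu a′ (side-self vu) s)

      leaving : ∀ {i j} → Side u v i → Adj G i j → Member j
      leaving {j = j} s a with side-split j uv
      ... | inj₁ s′ = inj₂ s′
      ... | inj₂ s′ = inj₁ (proj₂ (cross-edge uv a s s′))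

      to-u : ∀ k {x} → Side u v x → dist x u ≡ k → ∃ (Walk B x u)
      to-u zero s e with dist-0 e
      ... | refl = _ , [ _ ]
      to-u (suc k) {x} s e with closer e
      ... | w , xw , e′ with side-split w uv
      ...   | inj₁ s′ = _ , adjᵇ⁺ (inj₂ s) (inj₂ s′) xw ∷ proj₂ (to-u k s′ e′)
      ...   | inj₂ s′ with cross-edge uv xw s s′
      ...     | refl , _ = ⊥-elim (0≢1+n (trans (sym (dist-refl u)) e))

      to-v : ∀ {x} → Member x → ∃ (Walk B x v)
      to-v (inj₁ refl) = _ , [ v ]
      to-v (inj₂ s) = _ , proj₂ (to-u _ s refl) ++ʷ (adjᵇ⁺ u-member v-member uv ∷ [ v ])

      B-tree : IsTreeOn B (tabulate member)
      B-tree = record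
        { nonempty = v , ∈-tabulate⁺ member (member⁺ v-member)
        ; edgesIn = λ a → ∈-tabulate⁺ member (member⁺ (proj₁ (adjᵇ⁻ a))) ,
                          ∈-tabulate⁺ member (member⁺ (proj₁ (proj₂ (adjᵇ⁻ a))))
        ; connected = λ x y → _ , proj₂ (to-v (member⁻ (∈-tabulate⁻ member x))) ++ʷ
                                  reverseʷ (proj₂ (to-v (member⁻ (∈-tabulate⁻ member y))))
        ; acyclic = subgraph-acyclic {G = G} {B} (λ a → proj₂ (proj₂ (adjᵇ⁻ a))) (IsTreeOn.acyclic tree)
        }

    branch : Subtree G
    branch = record
      { support = tabulate member ; graph = B ; isTree = B-tree
      ; subgraph = λ a → proj₂ (proj₂ (adjᵇ⁻ a)) }

    branch-pendant : HasPendant v branch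
    branch-pendant = ∈-tabulate⁺ member (member⁺ v-member) ,
      trans (degree-count B v) (count-list (adjᵇ v) ([] ∷ []) λ x →
        mk⇔ (here ∘ neighbour-of-v) λ { (here refl) → adjᵇ⁺ v-member u-member vu })

    branch-adj : Adj (graph branch) v u
    branch-adj = adjᵇ⁺ v-member u-member vu

    -- A walk of `H` can leave the side of `u` only to `v`, and since `v` is pendant in `H`, it can
    -- go on from there only to `u`.
    branch-contains : (H : Subtree G) → HasPendant v H → Adj (graph H) v u → H ⊑ branch
    branch-contains H (v∈H , pendant) a =
      (λ x∈H → ∈-tabulate⁺ member (member⁺ (inside x∈H))) ,
      (λ e → adjᵇ⁺ (inside (proj₁ (edgesIn e))) (inside (proj₂ (edgesIn e))) (subgraph H e))
      where
      open IsTreeOn (isTree H)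
      stays : ∀ {x y k} → Walk (graph H) x y k → Member x → Member y
      stays [ _ ] m = m
      stays (e ∷ p) (inj₁ refl) with only-neighbour (graph H) pendant a e
      ... | refl = stays p u-member
      stays (e ∷ p) (inj₂ s) = stays p (leaving s (subgraph H e))
      inside : ∀ {x} → x Subset.∈ support H → Member x
      inside x∈H = stays (proj₂ (connected v∈H x∈H)) v-member

    -- Orient the edges of the branch towards `v`. Every vertex except `v` then has exactly one
    -- outgoing edge, and these vertices form the side of `u`.
    branch-edgeCount : edgeCount (graph branch) ≡ size u v
    branch-edgeCount = edgeCount-orientation B P (side u v) split P⇒adj
      (λ i j s t → <-asym (proj₂ (proj₂ (P⁻ s))) (proj₂ (proj₂ (P⁻ t)))) out
      where
      P : Fin n → Fin n → Bool
      P i j = side u v i ∧ (Graph.adj G i j ∧ ⌊ dist j v <? dist i v ⌋)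
      P⁺ : ∀ {i j} → Side u v i → Adj G i j → dist j v < dist i v → T (P i j)
      P⁺ s a lt = ∧⁺ (side⁺ s) (∧⁺ a (fromWitness lt))
      P⁻ : ∀ {i j} → T (P i j) → Side u v i × Adj G i j × dist j v < dist i v
      P⁻ {i} {j} t = side⁻ (∧ˡ (side u v i) t) , ∧ˡ (Graph.adj G i j) (∧ʳ (side u v i) t) ,
        toWitness (∧ʳ (Graph.adj G i j) (∧ʳ (side u v i) t))
      P⇒adj : ∀ i j → T (P i j) → Adj B i j
      P⇒adj i j t with P⁻ t
      ... | s , a , _ = adjᵇ⁺ (inj₂ s) (leaving s a) a
      oriented : ∀ {i j} → Member i → Adj G i j → dist i v ≡ suc (dist j v) → T (P i j)
      oriented (inj₁ refl) a e = ⊥-elim (0≢1+n (trans (sym (dist-refl v)) e))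
      oriented (inj₂ s) a e = P⁺ s a (≤-reflexive (sym e))
      split : ∀ i j → Adj B i j → T (P i j) ⊎ T (P j i)
      split i j e with adjᵇ⁻ e
      ... | mi , mj , a with edge-dist v a
      ...   | inj₁ eq = inj₁ (oriented mi a eq)
      ...   | inj₂ eq = inj₂ (oriented mj (Adj-sym {G = G} a) eq)
      out : ∀ i → count (P i) ≡ bit (side u v i)
      out i = go (dist u i <? dist v i) (dist i v) refl
        where
        go : Dec (Side u v i) → ∀ k → dist i v ≡ k → count (P i) ≡ bit (side u v i)
        go (no ¬s) k eq = trans (count-list (P i) [] λ j → mk⇔ (λ t → ⊥-elim (¬s (proj₁ (P⁻ t)))) λ ())
                                (sym (bit-¬T (¬s ∘ side⁻)))
        go (yes s) zero eq = ⊥-elim (¬Side-v (subst (Side u v) (dist-0 eq) s))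
        go (yes s) (suc k) eq with closer eq
        ... | c , ic , e = trans
          (count-list (P i) ([] ∷ []) λ j → mk⇔
            (λ t → here (unique-parent (proj₁ (proj₂ (P⁻ t))) ic (<⇒≤ (proj₂ (proj₂ (P⁻ t)))) (<⇒≤ lt)))
            λ { (here refl) → P⁺ s ic lt })
          (sym (bit-T (side⁺ s)))
          where
          lt : dist c v < dist i v
          lt = ≤-reflexive (trans (cong suc e) (sym eq))

    branch-isBranch : IsBranchAt v branch
    branch-isBranch = branch-pendant , λ K hp sub → case pendant-neighbour (graph K) (proj₂ hp) of λ where
      (w , vw) → branch-contains K hp (proj₂ sub branch-adj)

  edgeCount-⊑ : (H K : Subtree G) → H ⊑ K → K ⊑ H → edgeCount (graph H) ≡ edgeCount (graph K)
  edgeCount-⊑ H K (_ , hk) (_ , kh) = trans (edgeCount-Σᶠ (graph H)) (trans (Σᶠ-cong λ i → count-⇔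
      (λ j t → ∧⁺ (∧ˡ ⌊ i Fin.<? j ⌋ t) (hk (∧ʳ ⌊ i Fin.<? j ⌋ t)))
      (λ j t → ∧⁺ (∧ˡ ⌊ i Fin.<? j ⌋ t) (kh (∧ʳ ⌊ i Fin.<? j ⌋ t)))) (sym (edgeCount-Σᶠ (graph K))))

  -- The edge of `H` at `v` selects an explicit branch that contains `H`; by maximality the two have
  -- the same edges.
  branch-size : ∀ {v} (H : Subtree G) → IsBranchAt v H → ∃[ u ] Adj G v u × edgeCount (graph H) ≡ size u v
  branch-size {v} H (hp , max) with pendant-neighbour (graph H) (proj₂ hp)
  ... | u , a = u , subgraph H a , trans (edgeCount-⊑ H (branch uv) sub (max (branch uv) (branch-pendant uv) sub)) (branch-edgeCount uv)
    where
    uv : Adj G u v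
    uv = Adj-sym {G = G} (subgraph H a)
    sub : H ⊑ branch uv
    sub = branch-contains uv H hp a

-- Eccentricity and weight as functions; center and centroid.

module CC {n} (G : Graph n) (tree : IsTree G) (2≤n : 2 ≤ n) where

  open Metric G tree
  open Branch G tree

  some-neighbour : ∀ v → ∃[ u ] Adj G v u
  some-neighbour v = let w , v≢w = other 2≤n v in go w v≢w (dist v w) refl
    where
    other : ∀ {n} → 2 ≤ n → (v : Fin n) → ∃[ w ] v ≢ w
    other (s≤s (s≤s _)) zero = suc zero , λ ()
    other (s≤s (s≤s _)) (suc v) = zero , λ ()
    go : ∀ w → v ≢ w → ∀ k → dist v w ≡ k → ∃[ u ] Adj G v u
    go w v≢w zero e = ⊥-elim (v≢w (dist-0 e))
    go w v≢w (suc k) e = let u , a , _ = closer e in u , a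

  opaque
    heaviest : ∀ v → ∃[ u ] Adj G v u × (∀ {c} → Adj G v c → size c v ≤ size u v)
    heaviest v = found (argmax v f)
      where
      f : Fin n → ℕ
      -- Non-neighbours receive 0 while the size of a neighbour's side is positive, so the maximum
      -- over all vertices is attained at a neighbour.
      f u = if Graph.adj G v u then size u v else 0
      f-adj : ∀ {u} → Adj G v u → f u ≡ size u v
      f-adj {u} a with Graph.adj G v u
      ... | true = refl
      size>0 : ∀ {u} → Adj G v u → 1 ≤ size u v
      size>0 {u} a = subst (_≤ size u v) (count-single u)
        (count-mono λ x t → side⁺ (subst (Side u v) (sym (toWitness t)) (side-self (Adj-sym {G = G} a))))
      found : ∃[ i ] (∀ j → f j ≤ f i) → ∃[ u ] Adj G v u × (∀ {c} → Adj G v c → size c v ≤ size u v)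
      found (i , max) with T? (Graph.adj G v i)
      ... | yes a = i , a , λ {c} a′ → subst₂ _≤_ (f-adj a′) (f-adj a) (max c)
      ... | no ¬a = let w , vw = some-neighbour v in
        ⊥-elim (n≮0 (≤-trans (size>0 vw) (subst₂ _≤_ (f-adj vw) f-i (max w))))
        where
        f-i : f i ≡ 0
        f-i with Graph.adj G v i
        ... | true = ⊥-elim (¬a _)
        ... | false = refl

    farthest : ∀ v → ∃[ u ] ∀ w → dist w v ≤ dist u v
    farthest v = argmax v (λ u → dist u v)

  weight : Fin n → ℕ
  weight v = size (proj₁ (heaviest v)) v

  size≤weight : ∀ {v c} → Adj G v c → size c v ≤ weight v
  size≤weight {v} = proj₂ (proj₂ (heaviest v))

  weight-attained : ∀ v → ∃[ u ] Adj G v u × weight v ≡ size u v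
  weight-attained v = proj₁ (heaviest v) , proj₁ (proj₂ (heaviest v)) , refl

  weight-isWeight : ∀ v → IsWeight G v (weight v)
  weight-isWeight v = (branch uv , branch-isBranch uv , branch-edgeCount uv) ,
    λ { k (H , isB , refl) → let u , a , e = branch-size H isB in ≤-trans (≤-reflexive e) (size≤weight a) }
    where uv = Adj-sym {G = G} (proj₁ (proj₂ (heaviest v)))

  ecc : Fin n → ℕ
  ecc v = dist (proj₁ (farthest v)) v

  dist≤ecc : ∀ w v → dist w v ≤ ecc v
  dist≤ecc w v = proj₂ (farthest v) w

  ecc-attained : ∀ v → ∃[ u ] ecc v ≡ dist u v
  ecc-attained v = proj₁ (farthest v) , refl

  ecc-isEcc : ∀ v → IsEcc G v (ecc v)
  ecc-isEcc v = (proj₁ (farthest v) , dist-isDist _ _) ,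
    λ { k (u , isd) → subst (_≤ ecc v) (sym (dist-unique isd)) (dist≤ecc u v) }

  Center⁻ : ∀ {v} → Center G v → ∀ w → ecc v ≤ ecc w
  Center⁻ (e , isE , min) w = ≤-trans (≤-reflexive (IsMax-unique (ecc-isEcc _) isE)) (min w _ (ecc-isEcc w))

  Center⁺ : ∀ {v} → (∀ w → ecc v ≤ ecc w) → Center G v
  Center⁺ {v} min = ecc v , ecc-isEcc v , λ w e isE → subst (ecc v ≤_) (IsMax-unique (ecc-isEcc w) isE) (min w)

  Centroid⁻ : ∀ {v} → Centroid G v → ∀ w → weight v ≤ weight w
  Centroid⁻ (e , isW , min) w = ≤-trans (≤-reflexive (IsMax-unique (weight-isWeight _) isW)) (min w _ (weight-isWeight w))

  Centroid⁺ : ∀ {v} → (∀ w → weight v ≤ weight w) → Centroid G v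
  Centroid⁺ {v} min = weight v , weight-isWeight v , λ w e isW → subst (weight v ≤_) (IsMax-unique (weight-isWeight w) isW) (min w)

  MaxEccentric⁺ : ∀ {v} → (∀ w → ecc w ≤ ecc v) → MaxEccentric G v
  MaxEccentric⁺ {v} max = ecc v , ecc-isEcc v , λ w e isE → subst (_≤ ecc v) (IsMax-unique (ecc-isEcc w) isE) (max w)

  private
    Minimises : (Fin n → ℕ) → Fin n → Set
    Minimises f v = ∀ w → f v ≤ f w

    minimiser : (f : Fin n → ℕ) → Fin n → ∃ (Minimises f)
    minimiser f v with least {λ k → ∃[ w ] f w ≡ k} (λ k → any? λ w → f w ≟ⁿ k) (f v , v , refl)
      where open import Data.Nat using () renaming (_≟_ to _≟ⁿ_)
    ... | _ , (w , refl) , min = w , λ x → min _ (x , refl)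

    CCDist : ℕ → Set
    CCDist k = ∃[ x ] ∃[ y ] Minimises ecc x × Minimises weight y × dist x y ≡ k

  opaque
    -- With `ecc` and `weight` as functions, membership in the center and in the centroid is
    -- decidable, so the least distance exists by search; a minimiser of each function starts it.
    centerCentroidDist : ∃ (IsCenterCentroidDist G)
    centerCentroidDist with least {CCDist} ccDist? (_ , proj₁ c , proj₁ w , proj₂ c , proj₂ w , refl)
      where
      open import Data.Nat using () renaming (_≟_ to _≟ⁿ_)
      minimises? : ∀ f → Decidable (Minimises f)
      minimises? f v = all? λ w → f v ≤? f w
      ccDist? : Decidable CCDist
      ccDist? k = any? λ x → any? λ y → minimises? ecc x ×-dec (minimises? weight y ×-dec (dist x y ≟ⁿ k))
      vertex : Fin n
      vertex = fromℕ< (≤-trans (s≤s z≤n) 2≤n)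
      c : ∃ (Minimises ecc)
      c = minimiser ecc vertex
      w : ∃ (Minimises weight)
      w = minimiser weight vertex
    ... | k , (x , y , cx , wy , refl) , min =
      k , (x , y , Center⁺ cx , Centroid⁺ wy , dist-isDist x y) ,
      λ { j (x′ , y′ , cx′ , wy′ , isD) → min j (x′ , y′ , Center⁻ cx′ , Centroid⁻ wy′ , sym (dist-unique isD)) }

-- The upper bound for an arbitrary binary tree.

module BinaryTree {n} (G : Graph n) (binary : IsBinaryTree G) (2≤n : 2 ≤ n) where

  private
    tree : IsTree G
    tree = proj₁ binary

  open Metric G tree
  open Branch G tree
  open CC G tree 2≤n

  children : ∀ {u v} → Adj G u v → (∀ {w} → Adj G u w → w ≡ v) ⊎ OtherTwo G u v
  children {u} uv with degree G u ≟ⁿ 1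
    where open import Data.Nat using () renaming (_≟_ to _≟ⁿ_)
  ... | yes deg = inj₁ (only-neighbour G deg uv)
  ... | no ¬deg = inj₂ (other-two G (proj₂ binary u ¬deg) uv)

  module _ {u v} (uv : Adj G u v) (two : OtherTwo G u v) where

    open OtherTwo two

    private
      deeper : Fin n → Bool
      deeper x = side c₁ u x ∨ side c₂ u x

      deeper⁻ : ∀ x → T (deeper x) → Side c₁ u x ⊎ Side c₂ u x
      deeper⁻ x t = case Equivalence.to (T-∨ {side c₁ u x}) t of λ where
        (inj₁ s) → inj₁ (side⁻ s)
        (inj₂ s) → inj₂ (side⁻ s)

      deeper⁺ : ∀ x → T (side c₁ u x) ⊎ T (side c₂ u x) → T (deeper x)
      deeper⁺ x = Equivalence.from (T-∨ {side c₁ u x})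

    size-children-≤ : size u v ≤ 1 + (size c₁ u + size c₂ u)
    size-children-≤ = ≤-trans
      (count-cover {g = λ x → ⌊ x ≟ u ⌋} {deeper} cover)
      (+-mono-≤ (≤-reflexive (count-single u))
                (count-cover {f = deeper} {side c₁ u} {side c₂ u} λ x → Equivalence.to (T-∨ {side c₁ u x})))
      where
      cover : ∀ x → T (side u v x) → T ⌊ x ≟ u ⌋ ⊎ T (deeper x)
      cover x s with x ≟ u
      ... | yes _ = inj₁ _
      ... | no x≢u with side-child uv (side⁻ s) x≢u
      ...   | c , uc , c≢v , eq with all uc c≢v
      ...     | inj₁ refl = inj₂ (deeper⁺ x (inj₁ (side⁺ (≤-reflexive (sym eq)))))
      ...     | inj₂ refl = inj₂ (deeper⁺ x (inj₂ (side⁺ (≤-reflexive (sym eq)))))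

    size-children-≥ : 1 + (size c₁ u + size c₂ u) ≤ size u v
    size-children-≥ = ≤-trans
      (+-mono-≤ (≤-reflexive (sym (count-single u)))
                (count-disjoint {f = deeper} {side c₁ u} {side c₂ u} (λ x → deeper⁺ x ∘ inj₁) (λ x → deeper⁺ x ∘ inj₂)
                  λ x s t → c₁≢c₂ (side-disjoint adj₁ adj₂ (side⁻ s) (side⁻ t))))
      (count-disjoint {f = side u v} {λ x → ⌊ x ≟ u ⌋} {deeper}
        (λ x t → side⁺ (subst (Side u v) (sym (toWitness t)) (side-self uv)))
        (λ x t → side⁺ ([ side-extend uv adj₁ c₁≢v , side-extend uv adj₂ c₂≢v ]′ (deeper⁻ x t)))
        λ x t t′ → case toWitness t of λ { refl →
          [ (λ s → <-asym s (side-self adj₁)) , (λ s → <-asym s (side-self adj₂)) ]′ (deeper⁻ x t′) })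

  size>0 : ∀ {u v} → Adj G u v → 1 ≤ size u v
  size>0 {u} {v} uv = subst (_≤ size u v) (count-single u)
    (count-mono λ x t → side⁺ (subst (Side u v) (sym (toWitness t)) (side-self uv)))

  private
    double-step : ∀ {x y p} → suc x ≤ p → suc y ≤ p → suc (1 + (x + y)) ≤ 2 * p
    double-step {x} {y} {p} x< y< = lin 0 (+-mono-≤ x< y<) (solve (x ∷ᵛ y ∷ᵛ p ∷ᵛ []))

    lower-step : ∀ {k x y s} → 2 * k + 1 ≤ x → 1 ≤ y → 1 + (x + y) ≤ s → 2 * suc k + 1 ≤ s
    lower-step {k} {x} {y} {s} p q r = ≤-trans {j = 1 + (x + y)} (lin 0 (+-mono-≤ p q) (solve (k ∷ᵛ x ∷ᵛ y ∷ᵛ []))) r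

  -- Seen from `u`, every vertex of the side has at most two children, and `1 + 2 + ⋯ + 2 ^ h` is
  -- less than `2 ^ suc h`.
  size-upper : ∀ h {u v} → Adj G u v → (∀ x → Side u v x → dist u x ≤ h) → size u v < 2 ^ suc h
  size-upper h {u} {v} uv bound with children uv
  ... | inj₁ only = ≤-trans (s≤s (subst (size u v ≤_) (count-single u) (count-mono just-u)))
                            (≤-trans (m≤m*n 2 (2 ^ h) ⦃ m^n≢0 2 h ⦄) ≤-refl)
    where
    just-u : ∀ x → T (side u v x) → T ⌊ x ≟ u ⌋
    just-u x s with x ≟ u
    ... | yes _ = _
    ... | no x≢u = let c , uc , c≢v , _ = side-child uv (side⁻ s) x≢u in c≢v (only uc)
  size-upper zero {u} {v} uv bound | inj₂ two = ⊥-elim (n≮0 (subst (_≤ 0) (adj-dist adj₁)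
    (bound c₁ (side-extend uv adj₁ c₁≢v (side-self (Adj-sym {G = G} adj₁))))))
    where open OtherTwo two
  size-upper (suc h) {u} {v} uv bound | inj₂ two =
    ≤-trans (s≤s (size-children-≤ uv two))
            (double-step (recurse adj₁ c₁≢v) (recurse adj₂ c₂≢v))
    where
    open OtherTwo two
    recurse : ∀ {c} → Adj G u c → c ≢ v → size c u < 2 ^ suc h
    recurse uc c≢v = size-upper h (Adj-sym {G = G} uc) λ x s →
      s≤s⁻¹ (≤-trans s (bound x (side-extend uv uc c≢v s)))

  -- A vertex on the way from `u` to `z`, other than `z`, is not pendant and so has a second child
  -- off the way. Each step thus accounts for two vertices, and `z` is the extra one.
  size-lower : ∀ k {u v z} → Adj G u v → Side u v z → dist u z ≡ k → 2 * k + 1 ≤ size u v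
  size-lower zero uv s e = size>0 uv
  size-lower (suc k) {u} {v} {z} uv s e with side-child uv s (λ { refl → 0≢1+n (trans (sym (dist-refl u)) e) })
  ... | c , uc , c≢v , eq with children uv
  ...   | inj₁ only = ⊥-elim (c≢v (only uc))
  ...   | inj₂ two with OtherTwo.all two uc c≢v | size-children-≥ uv two
  ...     | inj₁ refl | ge = lower-step {k} (size-lower k (Adj-sym {G = G} uc) (≤-reflexive (sym eq)) (suc-injective (trans (sym eq) e)))
                              (size>0 (Adj-sym {G = G} (OtherTwo.adj₂ two))) ge
  ...     | inj₂ refl | ge = lower-step {k} (size-lower k (Adj-sym {G = G} uc) (≤-reflexive (sym eq)) (suc-injective (trans (sym eq) e)))
                              (size>0 (Adj-sym {G = G} (OtherTwo.adj₁ two)))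
                              (subst (_≤ size u v) (cong suc (+-comm (size (OtherTwo.c₁ two) u) _)) ge)

  private
    depth-bound : ∀ {k e x} → k + suc e ≤ suc x → k + e ≤ x
    depth-bound {k} {e} {x} p = lin 0 p (solve (k ∷ᵛ e ∷ᵛ x ∷ᵛ []))

    -- Here `d` is `suc k` and `x` is measured from `v`, which is already one step away from `w`. So
    -- `x` is at least `2d + h − 1`, and this missing step is why the bound is on `suc b`.
    total : ∀ {k h e x b} → suc k + h ≡ e → k + e ≤ x → 2 * x + 1 ≤ b → 2 * (suc k + suc k + h) ≤ suc b
    total {k} {h} {x = x} {b} refl p q = lin 0 (+-mono-≤ (+-mono-≤ p p) q) (solve (k ∷ᵛ h ∷ᵛ x ∷ᵛ b ∷ᵛ []))

  -- A and B are the sizes of the two sides of the first edge on the way from the centroid to the center.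
  -- The side A of the centroid has height at most h, and the other side contains, by the choice of the
  -- center, a vertex at distance 2d + h from the centroid.
  centerCentroid-bound : ∀ {d} → IsCenterCentroidDist G (suc d) → ∃[ h ] ∃[ A ] ∃[ B ]
    A + B ≡ n × B < A × A < 2 ^ suc h × 2 * (suc d + suc d + h) ≤ suc B
  centerCentroid-bound {k} ((c , w , isC , isW , isD) , min)
    with closer {w} {c} (trans (dist-sym w c) (sym (dist-unique isD))) | closer {c} {w} (sym (dist-unique isD))
  ... | v , wv , vc | c′ , cc′ , c′w =
    -- The height bound is read off the eccentricity of `c`: a vertex of the side of `w` reaches `c`
    -- only through `w`, which costs `suc k` more.
    ecc c ∸ suc k , size w v , size v w , size-sum wv , B<A ,
    size-upper _ wv (λ x s → m+n≤o⇒m≤o∸n (dist w x) (height x s)) ,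
    total {k} (m+[n∸m]≡n d≤ecc) far (size-lower _ vw z-beyond refl)
    where
    vw = Adj-sym {G = G} wv
    c′c = Adj-sym {G = G} cc′
    dcw : dist c w ≡ suc k
    dcw = sym (dist-unique isD)
    d≤ecc : suc k ≤ ecc c
    d≤ecc = subst (_≤ ecc c) (trans (dist-sym w c) dcw) (dist≤ecc w c)
    -- Otherwise `v` would also be a centroid vertex, one step closer to `c` than the minimal
    -- distance allows.
    v-heavier : weight w < weight v
    v-heavier with weight w <? weight v
    ... | yes lt = lt
    ... | no ≮ = ⊥-elim (1+n≰n (min k (c , v , isC , Centroid⁺ (λ x → ≤-trans (≮⇒≥ ≮) (Centroid⁻ isW x)) ,
                   subst (IsDist G c v) (trans (dist-sym c v) vc) (dist-isDist c v))))
    -- Any other branch at `v` lies inside the side of `v`, whose size is at most `weight w` and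
    -- hence below `weight v`.
    heaviest-is-w : ∀ u → Adj G v u → weight v ≡ size u v → u ≡ w
    heaviest-is-w u vu eq with u ≟ w
    ... | yes p = p
    ... | no u≢w = ⊥-elim (<⇒≱ v-heavier (≤-trans (≤-reflexive eq)
            (≤-trans (count-mono λ x s → side⁺ (side-extend vw vu u≢w (side⁻ s))) (size≤weight wv))))
    B<A : size v w < size w v
    B<A with weight-attained v
    ... | u , vu , eq with heaviest-is-w u vu eq
    ...   | refl = ≤-trans (s≤s (size≤weight wv)) (≤-trans v-heavier (≤-reflexive eq))
    c-beyond : Side v w c
    c-beyond = ≤-reflexive (trans (cong suc vc) (trans (sym dcw) (dist-sym c w)))
    height : ∀ x → Side w v x → dist w x + suc k ≤ ecc c
    height x s = subst₂ (λ p q → p + suc q ≤ ecc c) (dist-sym x w) vc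
      (≤-trans (crossing wv s c-beyond) (dist≤ecc x c))
    -- The same minimality at the other end: `c′` is one step closer to `w`, so it is not a center.
    -- A vertex `z` farthest from `c′` must then lie beyond `c`.
    c-better : ecc c < ecc c′
    c-better with ecc c <? ecc c′
    ... | yes lt = lt
    ... | no ≮ = ⊥-elim (1+n≰n (min k (c′ , w , Center⁺ (λ x → ≤-trans (≮⇒≥ ≮) (Center⁻ isC x)) , isW ,
                   subst (IsDist G c′ w) c′w (dist-isDist c′ w))))
    z : Fin n
    z = proj₁ (ecc-attained c′)
    c′z : ecc c < dist c′ z
    c′z = ≤-trans c-better (≤-reflexive (trans (proj₂ (ecc-attained c′)) (dist-sym z c′)))
    cz : dist c z ≤ ecc c
    cz = subst (_≤ ecc c) (dist-sym z c) (dist≤ecc z c)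
    cz′ : ecc c ≤ dist c z
    cz′ = s≤s⁻¹ (≤-trans c′z (dist-adj z c′c))
    -- As `z` lies beyond the edge `c′ c`, the distance from `w` adds up to `d + ecc c`, and `ecc c`
    -- is `d + h` by the choice of `h`.
    wz : k + suc (ecc c) ≤ dist w z
    wz = ≤-trans (+-mono-≤ (≤-reflexive (trans (sym c′w) (dist-sym c′ w))) (s≤s cz′))
           (crossing c′c (≤-reflexive (trans (cong suc c′w) (sym dcw))) (≤-trans (s≤s cz) c′z))
    z-beyond : Side v w z
    z-beyond = ≤-trans (s≤s (≤-trans (dist-triangle v c z) (+-mono-≤ (≤-reflexive vc) cz)))
                 (≤-trans (≤-reflexive (sym (+-suc k (ecc c)))) wz)
    far : k + ecc c ≤ dist v z
    far = depth-bound {k} (≤-trans wz (dist-adj z wv))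

-- Trees given by a parent function on numbers.

module Parent (par : ℕ → ℕ) (par< : ∀ {v} → 1 ≤ v → par v < v) where

  -- The first argument is fuel; since parents are smaller numbers, the vertex itself is enough of
  -- it.
  depthWithin : ℕ → ℕ → ℕ
  depthWithin zero _ = 0
  depthWithin (suc k) zero = 0
  depthWithin (suc k) (suc v) = suc (depthWithin k (par (suc v)))

  depth : ℕ → ℕ
  depth v = depthWithin v v

  depthWithin-depth : ∀ k j v → v ≤ k → v ≤ j → depthWithin k v ≡ depthWithin j v
  depthWithin-depth zero zero v _ _ = refl
  depthWithin-depth zero (suc j) zero _ _ = refl
  depthWithin-depth (suc k) zero zero _ _ = refl
  depthWithin-depth (suc k) (suc j) zero _ _ = refl
  depthWithin-depth (suc k) (suc j) (suc v) (s≤s p) (s≤s q) = cong suc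
    (depthWithin-depth k j _ (≤-trans par≤ p) (≤-trans par≤ q))
    where
    par≤ : par (suc v) ≤ v
    par≤ = s≤s⁻¹ (par< (s≤s z≤n))

  depth-par : ∀ {v} → 1 ≤ v → depth v ≡ suc (depth (par v))
  depth-par {suc v} _ = cong suc (depthWithin-depth v _ _ (s≤s⁻¹ (par< (s≤s z≤n))) ≤-refl)

  module _ {n : ℕ} where

    IsPar : Fin n → Fin n → Set
    IsPar u v = 1 ≤ toℕ v × toℕ u ≡ par (toℕ v)

    opaque
      isPar? : ∀ u v → Dec (IsPar u v)
      isPar? u v = (1 ≤? toℕ v) ×-dec (toℕ u ≟ⁿ par (toℕ v))
        where open import Data.Nat using () renaming (_≟_ to _≟ⁿ_)

    IsPar-< : ∀ {u v} → IsPar u v → toℕ u < toℕ v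
    IsPar-< (1≤v , eq) = subst (_< _) (sym eq) (par< 1≤v)

    IsPar-unique : ∀ {u u′ v} → IsPar u v → IsPar u′ v → u ≡ u′
    IsPar-unique (_ , e) (_ , e′) = Fin.toℕ-injective (trans e (sym e′))

    parentOf : (v : Fin n) → 1 ≤ toℕ v → Fin n
    parentOf v 1≤v = fromℕ< (<-trans (par< 1≤v) (Fin.toℕ<n v))

    parentOf-isPar : ∀ v (1≤v : 1 ≤ toℕ v) → IsPar (parentOf v 1≤v) v
    parentOf-isPar v 1≤v = 1≤v , Fin.toℕ-fromℕ< _

  graphᵖ : ∀ n → Graph n
  graphᵖ n = record
    { adj = λ u v → ⌊ isPar? u v ⌋ ∨ ⌊ isPar? v u ⌋
    ; sym = λ u v → ∨-comm ⌊ isPar? u v ⌋ _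
    ; irrefl = λ v → irr v (isPar? v v)
    }
    where
    open import Data.Bool.Properties using (∨-comm)
    irr : ∀ v (d : Dec (IsPar v v)) → ⌊ d ⌋ ∨ ⌊ d ⌋ ≡ false
    irr v (yes p) = ⊥-elim (<-irrefl refl (IsPar-< p))
    irr v (no _) = refl

  module _ {n : ℕ} where

    Adj⁺ : {u v : Fin n} → IsPar u v → Adj (graphᵖ n) u v
    Adj⁺ {u} {v} p = Equivalence.from (T-∨ {⌊ isPar? u v ⌋}) (inj₁ (fromWitness p))

    Adj⁺ʳ : {u v : Fin n} → IsPar v u → Adj (graphᵖ n) u v
    Adj⁺ʳ {u} {v} p = Equivalence.from (T-∨ {⌊ isPar? u v ⌋}) (inj₂ (fromWitness p))

    Adj⁻ : {u v : Fin n} → Adj (graphᵖ n) u v → IsPar u v ⊎ IsPar v u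
    Adj⁻ {u} {v} a = case Equivalence.to (T-∨ {⌊ isPar? u v ⌋}) a of λ where
      (inj₁ t) → inj₁ (toWitness t)
      (inj₂ t) → inj₂ (toWitness t)

  module Rooted (m : ℕ) where

    private
      n : ℕ
      n = suc m

    G : Graph n
    G = graphᵖ n

    root : Fin n
    root = zero

    root-walk : (v : Fin n) → Walk G v root (depth (toℕ v))
    root-walk v = go v (<-wellFounded (toℕ v))
      where
      go : (v : Fin n) → Acc _<_ (toℕ v) → Walk G v root (depth (toℕ v))
      go zero _ = [ zero ]
      go v@(suc _) (acc rs) = subst (Walk G v root)
          (trans (cong (suc ∘ depth) (proj₂ p)) (sym (depth-par (s≤s z≤n))))
          (Adj⁺ʳ p ∷ go (parentOf v (s≤s z≤n)) (rs (IsPar-< p)))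
        where p = parentOf-isPar v (s≤s z≤n)

    -- If the parent of `x` is off the path, the path can only go down at `x`. At the next vertex
    -- `x` is the parent that cannot be revisited, so the path descends to its end.
    below : ∀ {x v k z} (q : Walk G x v k) → IsPath q → IsPar z x → z ∉ vertices q →
            toℕ x ≤ toℕ v × (x ≡ v ⊎ ∃[ y ] IsPar y v × y ∈ vertices q)
    below [ v ] _ _ _ = ≤-refl , inj₁ refl
    below (a ∷ q) (x∉q ∷ iq) zx z∉ with Adj⁻ a
    ... | inj₂ x′x = ⊥-elim (z∉ (there (subst (_∈ vertices q) (IsPar-unique x′x zx) (first q))))
      where
      first : ∀ {x v k} (q : Walk G x v k) → x ∈ vertices q
      first [ _ ] = here refl
      first (_ ∷ _) = here refl
    ... | inj₁ xx′ with below q iq xx′ (All¬⇒¬Any x∉q)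
    ...   | le , inj₁ refl = ≤-trans (<⇒≤ (IsPar-< xx′)) le , inj₂ (_ , xx′ , here refl)
    ...   | le , inj₂ (y , yv , m) = ≤-trans (<⇒≤ (IsPar-< xx′)) le , inj₂ (y , yv , there m)

    -- A path that only climbs ends at a number no larger than its start; once it turns down,
    -- `below` takes over.
    end-parent : ∀ {x v k} (q : Walk G x v k) → IsPath q →
                 toℕ v ≤ toℕ x ⊎ ∃[ y ] IsPar y v × y ∈ vertices q
    end-parent [ v ] _ = inj₁ ≤-refl
    end-parent (a ∷ q) (x∉q ∷ iq) with Adj⁻ a
    ... | inj₂ x′x = case end-parent q iq of λ where
      (inj₁ le) → inj₁ (≤-trans le (<⇒≤ (IsPar-< x′x)))
      (inj₂ (y , yv , m)) → inj₂ (y , yv , there m)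
    ... | inj₁ xx′ = case below q iq xx′ (All¬⇒¬Any x∉q) of λ where
      (_ , inj₁ refl) → inj₂ (_ , xx′ , here refl)
      (_ , inj₂ (y , yv , m)) → inj₂ (y , yv , there m)

    last : ∀ {x v k} (q : Walk G x v k) → v ∈ vertices q
    last [ _ ] = here refl
    last (_ ∷ q) = there (last q)

    -- A path in G first goes up towards the root and then down.
    acyclic : Acyclic G
    acyclic (_ ∷ [ _ ]) _ (s≤s ()) _
    acyclic (a ∷ q@(_ ∷ q′)) (u∉ ∷ iq@(u₁∉ ∷ _)) _ vu with Adj⁻ a | Adj⁻ vu
    ... | inj₂ u₁u | inj₁ v-u = All¬⇒¬Any u₁∉ (subst (_∈ vertices q′) (IsPar-unique v-u u₁u) (last q′))
    ... | inj₂ u₁u | inj₂ u-v = case end-parent q iq of λ where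
      (inj₁ le) → <⇒≱ (<-trans (IsPar-< u₁u) (IsPar-< u-v)) le
      (inj₂ (y , yv , m)) → All¬⇒¬Any u∉ (subst (_∈ vertices q) (IsPar-unique yv u-v) m)
    ... | inj₁ uu₁ | v~u = case below q iq uu₁ (All¬⇒¬Any u∉) , v~u of λ where
      ((_ , inj₁ refl) , _) → All¬⇒¬Any u₁∉ (last q′)
      ((le , _) , inj₁ v-u) → <⇒≱ (<-trans (IsPar-< v-u) (IsPar-< uu₁)) le
      ((_ , inj₂ (y , yv , m)) , inj₂ u-v) → All¬⇒¬Any u∉ (subst (_∈ vertices q) (IsPar-unique yv u-v) m)

    rooted-isTree : IsTree G
    rooted-isTree = record
      { nonempty = root , Subset.∈⊤
      ; edgesIn = λ _ → Subset.∈⊤ , Subset.∈⊤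
      ; connected = λ {u} {v} _ _ → _ , root-walk u ++ʷ reverseʷ (root-walk v)
      ; acyclic = acyclic
      }

    open Metric G rooted-isTree public

    depth-walk : ∀ {u v k} → Walk G u v k → depth (toℕ u) ≤ k + depth (toℕ v)
    depth-walk [ _ ] = ≤-refl
    depth-walk {v = v} {k = suc k} (a ∷ p) with Adj⁻ a
    ... | inj₁ (1≤w , eq) = ≤-trans (n≤1+n _) (≤-trans (≤-reflexive (trans (cong (suc ∘ depth) eq) (sym (depth-par 1≤w))))
                              (≤-trans (depth-walk p) (n≤1+n _)))
    ... | inj₂ (1≤u , eq) = ≤-trans (≤-reflexive (trans (depth-par 1≤u) (cong (suc ∘ depth) (sym eq)))) (s≤s (depth-walk p))

    dist-root : ∀ v → dist v root ≡ depth (toℕ v)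
    dist-root v = ≤-antisym (dist-min (root-walk v))
      (≤-trans (depth-walk (dist-walk v root)) (≤-reflexive (+-identityʳ _)))

    module _ {v : Fin n} {xs : List (Fin n)} (uniq : Unique xs) (kids : ∀ w → IsPar v w ⇔ w ∈ xs) where

      degree-root : toℕ v ≡ 0 → degree G v ≡ length xs
      degree-root v≡0 = trans (degree-count G v) (count-list _ uniq λ w → mk⇔
        (λ a → [ Equivalence.to (kids w) , (λ p → ⊥-elim (n≮0 (subst (_ <_) v≡0 (IsPar-< p)))) ]′ (Adj⁻ a))
        (Adj⁺ ∘ Equivalence.from (kids w)))

      degree-inner : 1 ≤ toℕ v → degree G v ≡ suc (length xs)
      degree-inner 1≤v = trans (degree-count G v) (count-list _
        (¬Any⇒All¬ xs (λ m → <-asym (IsPar-< p) (IsPar-< (Equivalence.from (kids _) m))) ∷ uniq)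
        λ w → mk⇔
          (λ a → [ there ∘ Equivalence.to (kids w) , (λ q → here (IsPar-unique q p)) ]′ (Adj⁻ a))
          λ { (here refl) → Adj⁺ʳ p ; (there m) → Adj⁺ (Equivalence.from (kids w) m) })
        where p = parentOf-isPar v 1≤v

    NoChild : Fin n → Set
    NoChild v = ∀ w → ¬ IsPar v w

    record TwoChildren (v : Fin n) : Set where
      constructor twoChildren
      field
        {x y} : ℕ
        x≢y : x ≢ y
        x<n : x < n
        y<n : y < n
        1≤x : 1 ≤ x
        1≤y : 1 ≤ y
        parx : par x ≡ toℕ v
        pary : par y ≡ toℕ v
        only : ∀ {w} → 1 ≤ w → par w ≡ toℕ v → w ≡ x ⊎ w ≡ y

    noChild-kids : ∀ {v} → NoChild v → ∀ w → IsPar v w ⇔ w ∈ []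
    noChild-kids none w = mk⇔ (⊥-elim ∘ none w) λ ()

    private
      at : ∀ {x} (x<n : x < n) {w : Fin n} → toℕ w ≡ x → w ≡ fromℕ< x<n
      at x<n e = Fin.toℕ-injective (trans e (sym (Fin.toℕ-fromℕ< x<n)))

    module _ {v : Fin n} (two : TwoChildren v) where

      open TwoChildren two

      child₁ child₂ : Fin n
      child₁ = fromℕ< x<n
      child₂ = fromℕ< y<n

      child₁-isPar : IsPar v child₁
      child₁-isPar rewrite Fin.toℕ-fromℕ< x<n = 1≤x , sym parx

      child₂-isPar : IsPar v child₂
      child₂-isPar rewrite Fin.toℕ-fromℕ< y<n = 1≤y , sym pary

      children-unique : Unique (child₁ ∷ child₂ ∷ [])
      children-unique = ((λ e → x≢y (trans (sym (Fin.toℕ-fromℕ< x<n)) (trans (cong toℕ e) (Fin.toℕ-fromℕ< y<n)))) ∷ []) ∷ [] ∷ []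

      children-kids : ∀ w → IsPar v w ⇔ w ∈ (child₁ ∷ child₂ ∷ [])
      children-kids w = mk⇔
        (λ { (1≤w , e) → [ here ∘ at x<n , there ∘ here ∘ at y<n ]′ (only 1≤w (sym e)) })
        λ { (here refl) → child₁-isPar ; (there (here refl)) → child₂-isPar }

-- Gluing two rooted trees at their roots.

-- Parent functions of two trees rooted at 0, glued at the root: the vertices 0, …, m come from the first
-- tree, and the vertex j ≥ 1 of the second tree becomes m + j.
module Gluing (pA pB : ℕ → ℕ) (pA< : ∀ {v} → 1 ≤ v → pA v < v) (pB< : ∀ {v} → 1 ≤ v → pB v < v) (m : ℕ) where

  shift : ℕ → ℕ
  shift zero = zero
  shift (suc j) = m + suc j

  private
    choose : ∀ v → Dec (v ≤ m) → ℕ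
    choose v (yes _) = pA v
    choose v (no _) = shift (pB (v ∸ m))

  pT : ℕ → ℕ
  pT v = choose v (v ≤? m)

  pT-A : ∀ {v} → v ≤ m → pT v ≡ pA v
  pT-A {v} v≤m with v ≤? m
  ... | yes _ = refl
  ... | no ¬p = ⊥-elim (¬p v≤m)

  pT-B : ∀ {j} → 1 ≤ j → pT (shift j) ≡ shift (pB j)
  pT-B {suc j} _ with (m + suc j) ≤? m
  ... | yes p = ⊥-elim (m+1+n≰m m p)
  ... | no _ = cong (shift ∘ pB) (m+n∸m≡n m (suc j))

  shift-∸ : ∀ {v} → m < v → shift (v ∸ m) ≡ v
  shift-∸ {v} m<v with v ∸ m in eq
  ... | zero = ⊥-elim (<⇒≱ m<v (m∸n≡0⇒m≤n eq))
  ... | suc j = trans (cong (m +_) (sym eq)) (m+[n∸m]≡n (<⇒≤ m<v))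

  shift-pos : ∀ {j} → 1 ≤ j → m < shift j
  shift-pos {suc j} _ = subst (m <_) (sym (+-suc m j)) (s≤s (m≤m+n m j))

  shift-≤ : ∀ j → shift j ≤ m + j
  shift-≤ zero = z≤n
  shift-≤ (suc j) = ≤-refl

  shift-inj : ∀ {i j} → shift i ≡ shift j → i ≡ j
  shift-inj {zero} {zero} _ = refl
  shift-inj {zero} {suc j} e = ⊥-elim (n≮0 (subst (m <_) (sym e) (shift-pos {suc j} (s≤s z≤n))))
  shift-inj {suc i} {zero} e = ⊥-elim (n≮0 (subst (m <_) e (shift-pos {suc i} (s≤s z≤n))))
  shift-inj {suc i} {suc j} e = +-cancelˡ-≡ m _ _ e

  pT< : ∀ {v} → 1 ≤ v → pT v < v
  pT< {v} 1≤v with v ≤? m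
  ... | yes _ = pA< 1≤v
  ... | no ¬p = ≤-trans (s≤s (shift-≤ _))
    (≤-trans (≤-reflexive (sym (+-suc m _))) (≤-trans (+-monoʳ-≤ m (pB< (m<n⇒0<n∸m (≰⇒> ¬p))))
      (≤-reflexive (m+[n∸m]≡n (<⇒≤ (≰⇒> ¬p))))))

  private
    module A = Parent pA pA<
    module B = Parent pB pB<
    module G = Parent pT pT<

  module _ (N : ℕ) where

    f : Fin (suc m) → Fin (suc (m + N))
    f i = fromℕ< (≤-trans (Fin.toℕ<n i) (s≤s (m≤m+n m N)))

    toℕ-f : ∀ i → toℕ (f i) ≡ toℕ i
    toℕ-f i = Fin.toℕ-fromℕ< _

    g : Fin (suc N) → Fin (suc (m + N))
    g j = fromℕ< (s≤s (≤-trans (shift-≤ _) (+-monoʳ-≤ m (s≤s⁻¹ (Fin.toℕ<n j)))))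

    toℕ-g : ∀ j → toℕ (g j) ≡ shift (toℕ j)
    toℕ-g j = Fin.toℕ-fromℕ< _

    f-hit : ∀ {x : Fin (suc (m + N))} → toℕ x ≤ m → ∃[ i ] f i ≡ x
    f-hit {x} le = fromℕ< (s≤s le) , Fin.toℕ-injective (trans (toℕ-f _) (Fin.toℕ-fromℕ< (s≤s le)))

    g-hit : ∀ {x : Fin (suc (m + N))} k → k < suc N → shift k ≡ toℕ x → ∃[ j ] g j ≡ x × toℕ j ≡ k
    g-hit k lt e = fromℕ< lt ,
      Fin.toℕ-injective (trans (toℕ-g (fromℕ< lt)) (trans (cong shift (Fin.toℕ-fromℕ< lt)) e)) , Fin.toℕ-fromℕ< lt

    f-isPar : ∀ {i j} → A.IsPar i j → G.IsPar (f i) (f j)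
    f-isPar {i} {j} (1≤j , e) = subst (1 ≤_) (sym (toℕ-f j)) 1≤j ,
      trans (toℕ-f i) (trans e (trans (sym (pT-A (s≤s⁻¹ (Fin.toℕ<n j)))) (cong pT (sym (toℕ-f j)))))

    g-isPar : ∀ {i j} → B.IsPar i j → G.IsPar (g i) (g j)
    g-isPar {i} {j} (1≤j , e) = subst (1 ≤_) (sym (toℕ-g j)) (≤-trans (s≤s z≤n) (shift-pos 1≤j)) ,
      trans (toℕ-g i) (trans (cong shift e) (trans (sym (pT-B 1≤j)) (cong pT (sym (toℕ-g j)))))

    isPar-split : ∀ {x y} → G.IsPar x y →
      (∃[ i ] ∃[ j ] f i ≡ x × f j ≡ y × A.IsPar i j) ⊎ (∃[ i ] ∃[ j ] g i ≡ x × g j ≡ y × B.IsPar i j)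
    isPar-split {x} {y} p@(1≤y , e) = go (toℕ y ≤? m)
      where
      inB : m < toℕ y → 1 ≤ toℕ y ∸ m
      inB = m<n⇒0<n∸m
      go : Dec (toℕ y ≤ m) → _
      go (yes y≤m) with f-hit {x} (≤-trans (<⇒≤ (G.IsPar-< {u = x} {y} p)) y≤m) | f-hit {y} y≤m
      ... | i , ei | j , ej = inj₁ (i , j , ei , ej , subst (1 ≤_) (sym j≡y) 1≤y ,
          trans (sym (toℕ-f i)) (trans (cong toℕ ei) (trans e (trans (pT-A y≤m) (cong pA (sym j≡y))))))
        where
        j≡y : toℕ j ≡ toℕ y
        j≡y = trans (sym (toℕ-f j)) (cong toℕ ej)
      go (no y≰m) with g-hit {y} (toℕ y ∸ m)
          (s≤s (≤-trans (∸-monoˡ-≤ m (s≤s⁻¹ (Fin.toℕ<n y))) (≤-reflexive (m+n∸m≡n m N)))) (shift-∸ (≰⇒> y≰m))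
      ... | j , ej , j≡ with g-hit {x} (pB (toℕ j)) (<-trans (pB< 1≤j) (Fin.toℕ<n j))
              (trans (sym (pT-B 1≤j)) (trans (cong pT (trans (sym (toℕ-g j)) (cong toℕ ej))) (sym e)))
        where
        1≤j : 1 ≤ toℕ j
        1≤j = subst (1 ≤_) (sym j≡) (inB (≰⇒> y≰m))
      ...   | i , ei , i≡ = inj₂ (i , j , ei , ej , subst (1 ≤_) (sym j≡) (inB (≰⇒> y≰m)) , i≡)

    identification : IsIdentification (A.graphᵖ (suc m)) zero (B.graphᵖ (suc N)) zero (G.graphᵖ (suc (m + N)))
    identification = record
      { f = f
      ; g = g
      ; f-inj = λ {i} {j} e → Fin.toℕ-injective (trans (sym (toℕ-f i)) (trans (cong toℕ e) (toℕ-f j)))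
      ; g-inj = λ {i} {j} e → Fin.toℕ-injective (shift-inj (trans (sym (toℕ-g i)) (trans (cong toℕ e) (toℕ-g j))))
      ; glued = Fin.toℕ-injective (trans (toℕ-f zero) (sym (toℕ-g zero)))
      ; meet = λ i j e → meet i j (trans (sym (toℕ-f i)) (trans (cong toℕ e) (toℕ-g j)))
      ; cover = cover
      ; edges = λ x y → mk⇔ (to ∘ G.Adj⁻) from
      }
      where
      meet : ∀ i j → toℕ i ≡ shift (toℕ j) → i ≡ zero × j ≡ zero
      meet i zero e = Fin.toℕ-injective e , refl
      meet i j@(suc _) e = ⊥-elim (<⇒≱ (shift-pos {toℕ j} (s≤s z≤n)) (subst (_≤ m) e (s≤s⁻¹ (Fin.toℕ<n i))))
      cover : ∀ x → (∃[ i ] f i ≡ x) ⊎ (∃[ j ] g j ≡ x)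
      cover x with toℕ x ≤? m
      ... | yes le = inj₁ (f-hit le)
      ... | no ≰ = let j , e , _ = g-hit {x} (toℕ x ∸ m)
                         (s≤s (≤-trans (∸-monoˡ-≤ m (s≤s⁻¹ (Fin.toℕ<n x))) (≤-reflexive (m+n∸m≡n m N))))
                         (shift-∸ (≰⇒> ≰)) in inj₂ (j , e)
      to : ∀ {x y} → G.IsPar x y ⊎ G.IsPar y x → _
      to (inj₁ p) = case isPar-split p of λ where
        (inj₁ (i , j , e , e′ , q)) → inj₁ (i , j , e , e′ , A.Adj⁺ q)
        (inj₂ (i , j , e , e′ , q)) → inj₂ (i , j , e , e′ , B.Adj⁺ q)
      to (inj₂ p) = case isPar-split p of λ where
        (inj₁ (i , j , e , e′ , q)) → inj₁ (j , i , e′ , e , A.Adj⁺ʳ q)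
        (inj₂ (i , j , e , e′ , q)) → inj₂ (j , i , e′ , e , B.Adj⁺ʳ q)
      from : ∀ {x y} → (∃[ i ] ∃[ j ] f i ≡ x × f j ≡ y × Adj (A.graphᵖ (suc m)) i j) ⊎
                       (∃[ i ] ∃[ j ] g i ≡ x × g j ≡ y × Adj (B.graphᵖ (suc N)) i j) →
             Adj (G.graphᵖ (suc (m + N))) x y
      from (inj₁ (i , j , refl , refl , a)) = [ G.Adj⁺ ∘ f-isPar , G.Adj⁺ʳ ∘ f-isPar ]′ (A.Adj⁻ a)
      from (inj₂ (i , j , refl , refl , a)) = [ G.Adj⁺ ∘ g-isPar , G.Adj⁺ʳ ∘ g-isPar ]′ (B.Adj⁻ a)

-- The heap is an rgood tree.

half-suc-double : ∀ i → ⌊ suc (i + i) /2⌋ ≡ i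
half-suc-double zero = refl
half-suc-double (suc i) = trans (cong (λ z → suc ⌊ z /2⌋) (+-suc i i)) (cong suc (half-suc-double i))

half-double : ∀ i → ⌊ i + i /2⌋ ≡ i
half-double i = sym (n≡⌊n+n/2⌋ i)

half-cases : ∀ m → m ≡ ⌊ m /2⌋ + ⌊ m /2⌋ ⊎ m ≡ suc (⌊ m /2⌋ + ⌊ m /2⌋)
half-cases zero = inj₁ refl
half-cases (suc zero) = inj₂ refl
half-cases (suc (suc m)) = case half-cases m of λ where
  (inj₁ e) → inj₁ (cong suc (trans (cong suc e) (sym (+-suc ⌊ m /2⌋ ⌊ m /2⌋))))
  (inj₂ e) → inj₂ (cong suc (cong suc (trans e (sym (+-suc ⌊ m /2⌋ ⌊ m /2⌋)))))

heapParent : ℕ → ℕ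
heapParent v = ⌊ pred v /2⌋

heapParent< : ∀ {v} → 1 ≤ v → heapParent v < v
heapParent< {suc v} _ = s≤s (⌊n/2⌋≤n v)

module HeapDepth = Parent heapParent heapParent<

heapParent-mono : ∀ {u v} → u ≤ v → heapParent u ≤ heapParent v
heapParent-mono p = ⌊n/2⌋-mono (pred-mono-≤ p)

heap-children : ∀ {w i} → 1 ≤ w → heapParent w ≡ i → w ≡ suc (i + i) ⊎ w ≡ suc (suc (i + i))
heap-children {suc w} _ refl = case half-cases w of λ where
  (inj₁ e) → inj₁ (cong suc e)
  (inj₂ e) → inj₂ (cong suc e)

-- Because `heapParent` is monotone, the levels of the heap are consecutive intervals of numbers,
-- and heights can be compared through numbers.
heap-depth-mono : ∀ {u v} → u ≤ v → HeapDepth.depth u ≤ HeapDepth.depth v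
heap-depth-mono {u} {v} = go v u (<-wellFounded v)
  where
  open HeapDepth
  go : ∀ v u → Acc _<_ v → u ≤ v → depth u ≤ depth v
  go v zero _ _ = z≤n
  go v@(suc _) u@(suc _) (acc rs) u≤v = subst₂ _≤_ (sym (depth-par {u} (s≤s z≤n))) (sym (depth-par {v} (s≤s z≤n)))
    (s≤s (go (heapParent v) (heapParent u) (rs (heapParent< (s≤s z≤n))) (heapParent-mono u≤v)))

-- Level `d` of the heap begins at the number `2 ^ d − 1`.
heap-depth-bound : ∀ v → 2 ^ HeapDepth.depth v ≤ suc v
heap-depth-bound v = go v (<-wellFounded v)
  where
  open HeapDepth
  double : ∀ {x i} → x ≤ suc i → 2 * x ≤ suc (suc (i + i))
  double {x} {i} p = lin 0 (+-mono-≤ p p) (solve (x ∷ᵛ i ∷ᵛ []))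
  go : ∀ v → Acc _<_ v → 2 ^ depth v ≤ suc v
  go zero _ = ≤-refl
  go v@(suc v′) (acc rs) = ≤-trans (≤-reflexive (cong (2 ^_) (depth-par {v} (s≤s z≤n))))
    (≤-trans (double (go (heapParent v) (rs (heapParent< {v} (s≤s z≤n)))))
      (s≤s (s≤s ([ (λ e → ≤-reflexive (sym e)) , (λ e → ≤-trans (n≤1+n _) (≤-reflexive (sym e))) ]′ (half-cases v′)))))

module Heap (a : ℕ) (1≤a : 1 ≤ a) where

  open HeapDepth
  open Rooted (a + a)

  private
    l : ℕ
    l = suc (a + a)

    -- The children `2i + 1` and `2i + 2` are both at most `2a` when `i < a`, and both exceed it
    -- otherwise; so the leaves are `a, …, 2a`.
    internal : (v : Fin l) → toℕ v < a → TwoChildren v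
    internal v v<a = record
      { x≢y = λ e → 1+n≢n (sym e)
      ; x<n = ≤-trans (n≤1+n _) bound
      ; y<n = bound
      ; 1≤x = s≤s z≤n
      ; 1≤y = s≤s z≤n
      ; parx = half-double (toℕ v)
      ; pary = half-suc-double (toℕ v)
      ; only = heap-children
      }
      where
      bound : suc (suc (toℕ v + toℕ v)) < l
      bound = s≤s (subst (_≤ a + a) (cong suc (+-suc _ _)) (+-mono-≤ v<a v<a))

    external : (v : Fin l) → a ≤ toℕ v → NoChild v
    external v a≤v w (1≤w , e) = <⇒≱ (s≤s (+-mono-≤ a≤v a≤v))
      (≤-trans ([ (λ e → ≤-reflexive (sym e)) , (λ e → ≤-trans (n≤1+n _) (≤-reflexive (sym e))) ]′ (heap-children {i = toℕ v} 1≤w (sym e)))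
               (s≤s⁻¹ (Fin.toℕ<n w)))

    degree-external : ∀ v → a ≤ toℕ v → degree G v ≡ 1
    degree-external v a≤v = degree-inner {v} [] (noChild-kids (external v a≤v)) (≤-trans 1≤a a≤v)

    degree-internal : ∀ v → toℕ v < a → v ≢ root → degree G v ≡ 3
    degree-internal v v<a v≢r = degree-inner {v} (children-unique two) (children-kids two)
      (n≢0⇒n>0 λ e → v≢r (Fin.toℕ-injective e))
      where two = internal v v<a

    height⁺ : ∀ v → IsHeight G root v (depth (toℕ v))
    height⁺ v = subst (IsDist G v root) (dist-root v) (dist-isDist v root)

    height⁻ : ∀ {v h} → IsHeight G root v h → h ≡ depth (toℕ v)
    height⁻ {v} p = trans (dist-unique p) (dist-root v)

    height-child : ∀ {p v h} → IsPar p v → IsHeight G root p h → IsHeight G root v (suc h)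
    height-child {v = v} (1≤v , e) p = subst (IsHeight G root v)
      (trans (depth-par 1≤v) (cong suc (trans (cong depth (sym e)) (sym (height⁻ p))))) (height⁺ v)

    isParent⁻ : ∀ {h p v} → IsParent G root h p v → IsPar p v
    isParent⁻ (a , hp , hv) with Adj⁻ a
    ... | inj₁ p = p
    ... | inj₂ q = ⊥-elim (m≢1+n+m _ {1} (IsMin-unique hp (height-child q hv)))

    -- The leaves are numbered from `a` to `2a`, and the parent of `2a` is at most `a`, so the last
    -- leaf is at most one level below `a`.
    external-depth : ∀ {v : Fin l} → a ≤ toℕ v → depth a ≤ depth (toℕ v) × depth (toℕ v) ≤ suc (depth a)
    external-depth {v} a≤v = heap-depth-mono a≤v ,
      ≤-trans (heap-depth-mono (s≤s⁻¹ (Fin.toℕ<n v)))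
        (≤-trans (≤-reflexive (depth-par {a + a} (≤-trans 1≤a (m≤m+n a a))))
          (s≤s (heap-depth-mono (≤-trans (heapParent-mono (n≤1+n (a + a))) (≤-reflexive (half-double a))))))

    pendant⁻ : ∀ {v} → Pendant G v → a ≤ toℕ v
    pendant⁻ {v} pend with toℕ v <? a
    ... | no v≮a = ≮⇒≥ v≮a
    ... | yes v<a with v ≟ root
    ...   | no v≢r = case trans (sym pend) (degree-internal v v<a v≢r) of λ ()
    ...   | yes refl = case trans (sym pend) (degree-root {root} (children-unique two) (children-kids two) refl) of λ ()
      where two = internal root v<a

    near : ∀ {D x y} → D ≤ x × x ≤ suc D → D ≤ y × y ≤ suc D → ∣ x - y ∣ ≤ 1
    near {D} {x} {y} (Dx , xD) (Dy , yD) with ≤-total x y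
    ... | inj₁ le = subst (_≤ 1) (sym (m≤n⇒∣m-n∣≡n∸m le)) (≤-trans (∸-mono yD Dx) (≤-reflexive (m+n∸n≡m 1 D)))
    ... | inj₂ le = subst (_≤ 1) (sym (m≤n⇒∣n-m∣≡n∸m le)) (≤-trans (∸-mono xD Dy) (≤-reflexive (m+n∸n≡m 1 D)))

    -- The last level of the heap is filled from the left, so the ordering runs from right to left.
    _≺_ : Rel (Fin l) 0ℓ
    u ≺ v = v Fin.< u

    ordering : IsOrdering G root _≺_
    ordering = record
      { linear = λ h _ → On.isStrictTotalOrder proj₁ (Flip.isStrictTotalOrder (Fin.<-isStrictTotalOrder {l}))
      ; compatible = λ h _ pu qv p≢q → compatible (isParent⁻ pu) (isParent⁻ qv) p≢q
      }
      where
      import Relation.Binary.Construct.On as On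
      import Relation.Binary.Construct.Flip.EqAndOrd as Flip
      compatible : ∀ {p q u v} → IsPar p u → IsPar q v → p ≢ q → (u ≺ v ⇔ p ≺ q)
      compatible (_ , ep) (_ , eq) p≢q = mk⇔
        (λ v<u → ≤∧≢⇒< (subst₂ _≤_ (sym eq) (sym ep) (heapParent-mono (<⇒≤ v<u))) (λ e → p≢q (sym (Fin.toℕ-injective e))))
        (λ q<p → ≰⇒> λ u≤v → <⇒≱ q<p (subst₂ _≤_ (sym ep) (sym eq) (heapParent-mono u≤v)))

  heap-rgood : IsRgood G root
  heap-rgood = (rooted-isTree , inj₂ (root-degree , degrees)) ,
    (λ u v hu hv pu pv u-h v-h → subst₂ (λ x y → ∣ x - y ∣ ≤ 1) (sym (height⁻ u-h)) (sym (height⁻ v-h))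
      (near {depth a} (external-depth (pendant⁻ pu)) (external-depth (pendant⁻ pv)))) ,
    _≺_ , ordering , final
    where
    root-degree : degree G root ≡ 2
    root-degree = degree-root {root} (children-unique two) (children-kids two) refl
      where two = internal root 1≤a
    degrees : ∀ v → v ≢ root → degree G v ≡ 1 ⊎ degree G v ≡ 3
    degrees v v≢r with toℕ v <? a
    ... | yes v<a = inj₂ (degree-internal v v<a v≢r)
    ... | no v≮a = inj₁ (degree-external v (≮⇒≥ v≮a))
    final : ∀ h → IsMax (Level G root) (suc h) → ∀ p q → HasPendantChild G root h p → IsHeight G root q h →
            p ≺ q → HasPendantChild G root h q
    final h (_ , max) p q (v , _ , pv) q-h q<p =
      c , degree-external c (≮⇒≥ c≮a) , Adj⁺ (child₁-isPar two) , q-h , c-h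
      where
      p<a : toℕ p < a
      p<a = ≰⇒> λ a≤p → external p a≤p v (isParent⁻ pv)
      two = internal q (<-trans q<p p<a)
      c = child₁ two
      c-h = height-child (child₁-isPar two) q-h
      -- The child `c` of `q` is on the highest level already; if it were internal, its own child
      -- would lie on a still higher one.
      c≮a : ¬ toℕ c < a
      c≮a c<a = 1+n≰n (max _ (child₁ two′ , height-child (child₁-isPar two′) c-h))
        where two′ = internal c c<a

-- The binary caterpillar and its distances.

-- The spine of the caterpillar is 0, 1, 3, 5, …; the vertex 2t with t ≥ 1 is a leg at the spine vertex 2t − 1.
spine : ℕ → ℕ
spine t = pred (t + t)

-- Both `2t` and `2t + 1` hang from `spine t`: for `t ≥ 1` these are its leg and the next spine
-- vertex, while for `t = 0` the root gets the single child 1 and is pendant.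
caterpillarParent : ℕ → ℕ
caterpillarParent v = spine ⌊ v /2⌋

caterpillarParent< : ∀ {v} → 1 ≤ v → caterpillarParent v < v
caterpillarParent< {v} 1≤v = below-v _ 2⌊v/2⌋≤v
  where
  2⌊v/2⌋≤v : ⌊ v /2⌋ + ⌊ v /2⌋ ≤ v
  2⌊v/2⌋≤v = [ (λ e → ≤-reflexive (sym e)) , (λ e → ≤-trans (n≤1+n _) (≤-reflexive (sym e))) ]′ (half-cases v)
  below-v : ∀ x → x ≤ v → pred x < v
  below-v zero _ = 1≤v
  below-v (suc x) le = le

module CaterpillarDepth = Parent caterpillarParent caterpillarParent<

spine-suc : ∀ t → spine (suc t) ≡ suc (t + t)
spine-suc t = +-suc t t

spine-pos : ∀ {t} → 1 ≤ t → 1 ≤ spine t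
spine-pos {suc t} _ = subst (1 ≤_) (sym (spine-suc t)) (s≤s z≤n)

spine-parent : ∀ t → caterpillarParent (spine (suc t)) ≡ spine t
spine-parent t = cong spine (trans (cong ⌊_/2⌋ (spine-suc t)) (half-suc-double t))

spine-depth : ∀ t → CaterpillarDepth.depth (spine t) ≡ t
spine-depth zero = refl
spine-depth (suc t) = trans (CaterpillarDepth.depth-par (spine-pos {suc t} (s≤s z≤n)))
  (cong suc (trans (cong CaterpillarDepth.depth (spine-parent t)) (spine-depth t)))

spine-mono : ∀ {i j} → i ≤ j → spine i ≤ spine j
spine-mono p = pred-mono-≤ (+-mono-≤ p p)

spine-inj : ∀ {i j} → spine i ≡ spine j → i ≡ j
spine-inj {i} {j} e = trans (sym (spine-depth i)) (trans (cong CaterpillarDepth.depth e) (spine-depth j))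

spine≢leg : ∀ {h t} → 1 ≤ t → spine h ≢ t + t
spine≢leg {zero} {suc t} _ ()
spine≢leg {suc h} {t} _ e = 1+n≢n (trans e′ (cong₂ _+_ (sym h≡t) (sym h≡t)))
  where
  e′ : suc (h + h) ≡ t + t
  e′ = trans (sym (spine-suc h)) e
  h≡t : h ≡ t
  h≡t = trans (sym (half-suc-double h)) (trans (cong ⌊_/2⌋ e′) (half-double t))

caterpillar-children : ∀ {w t} → caterpillarParent w ≡ spine t → w ≡ t + t ⊎ w ≡ suc (t + t)
caterpillar-children {w} {t} e with spine-inj {⌊ w /2⌋} {t} e
... | refl = half-cases w

module Caterpillar (s : ℕ) where

  open CaterpillarDepth
  open Rooted (suc (s + s))

  private
    n : ℕ
    n = suc (suc (s + s))

  2≤n : 2 ≤ n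
  2≤n = s≤s (s≤s z≤n)

  spine≤ : ∀ {t} → t ≤ suc s → spine t ≤ suc (s + s)
  spine≤ p = ≤-trans (spine-mono p) (≤-reflexive (spine-suc s))

  spineVertex : ∀ t → t ≤ suc s → Fin n
  spineVertex t p = fromℕ< (s≤s (spine≤ p))

  toℕ-spineVertex : ∀ t p → toℕ (spineVertex t p) ≡ spine t
  toℕ-spineVertex t p = Fin.toℕ-fromℕ< (s≤s (spine≤ p))

  data View (v : Fin n) : Set where
    onSpine : ∀ t → t ≤ suc s → toℕ v ≡ spine t → View v
    leg : ∀ t → 1 ≤ t → t ≤ s → toℕ v ≡ t + t → View v

  view : ∀ v → View v
  view v = go ⌊ toℕ v /2⌋ (≤-trans (⌊n/2⌋-mono (s≤s⁻¹ (Fin.toℕ<n v))) (≤-reflexive (half-suc-double s))) (half-cases (toℕ v))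
    where
    go : ∀ h → h ≤ s → toℕ v ≡ h + h ⊎ toℕ v ≡ suc (h + h) → View v
    go zero _ (inj₁ e) = onSpine 0 z≤n e
    go (suc h) le (inj₁ e) = leg (suc h) (s≤s z≤n) le e
    go h le (inj₂ e) = onSpine (suc h) (s≤s le) (trans e (sym (spine-suc h)))

  private
    leg-external : ∀ {v t} → 1 ≤ t → toℕ v ≡ t + t → NoChild v
    leg-external 1≤t e w (_ , p) = spine≢leg {⌊ toℕ w /2⌋} 1≤t (trans (sym p) e)

    last-external : ∀ {v} → toℕ v ≡ spine (suc s) → NoChild v
    last-external e w (_ , p) = <⇒≱ (Fin.toℕ<n w)
      ([ (λ q → subst (n ≤_) (sym q) (s≤s (≤-reflexive (sym (+-suc s s)))))
       , (λ q → subst (n ≤_) (sym q) (≤-trans (s≤s (≤-reflexive (sym (+-suc s s)))) (n≤1+n _))) ]′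
       (caterpillar-children {toℕ w} {suc s} (trans (sym p) e)))

    spine-internal : ∀ {v t} → 1 ≤ t → t ≤ s → toℕ v ≡ spine t → TwoChildren v
    spine-internal {v} {t} 1≤t t≤s e = record
      { x≢y = λ q → 1+n≢n (sym q)
      ; x<n = s≤s (≤-trans t+t≤ (n≤1+n _))
      ; y<n = s≤s (s≤s t+t≤)
      ; 1≤x = ≤-trans 1≤t (m≤m+n t t)
      ; 1≤y = s≤s z≤n
      ; parx = trans (cong spine (half-double t)) (sym e)
      ; pary = trans (cong spine (half-suc-double t)) (sym e)
      ; only = λ {w} _ q → caterpillar-children {w} {t} (trans q e)
      }
      where
      t+t≤ : t + t ≤ s + s
      t+t≤ = +-mono-≤ t≤s t≤s

    root-degree : degree G root ≡ 1
    root-degree = degree-root {root} {spineVertex 1 (s≤s z≤n) ∷ []} ([] ∷ []) kids refl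
      where
      one : spineVertex 1 (s≤s z≤n) ≡ suc zero
      one = Fin.toℕ-injective (toℕ-spineVertex 1 (s≤s z≤n))
      kids : ∀ w → IsPar root w ⇔ w ∈ (spineVertex 1 (s≤s z≤n) ∷ [])
      kids w = mk⇔ to λ { (here refl) → subst (IsPar root) (sym one) (s≤s z≤n , refl) }
        where
        to : IsPar root w → w ∈ (spineVertex 1 (s≤s z≤n) ∷ [])
        to (1≤w , p) with caterpillar-children {toℕ w} {0} (sym p)
        ... | inj₁ q = ⊥-elim (n≮0 (subst (1 ≤_) q 1≤w))
        ... | inj₂ q = here (Fin.toℕ-injective (trans q (sym (toℕ-spineVertex 1 (s≤s z≤n)))))

    degrees : ∀ v → degree G v ≡ 1 ⊎ degree G v ≡ 3
    degrees v with view v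
    ... | leg t 1≤t t≤s e = inj₁ (degree-inner {v} [] (noChild-kids (leg-external {v} 1≤t e))
                              (subst (1 ≤_) (sym e) (≤-trans 1≤t (m≤m+n t t))))
    ... | onSpine zero _ e = inj₁ (subst (λ v → degree G v ≡ 1) (sym (Fin.toℕ-injective e)) root-degree)
    ... | onSpine (suc t) le e with m≤n⇒m<n∨m≡n le
    ...   | inj₁ (s≤s lt) = inj₂ (degree-inner {v} (children-unique two) (children-kids two)
                              (subst (1 ≤_) (sym e) (spine-pos {suc t} (s≤s z≤n))))
      where two = spine-internal {v} (s≤s z≤n) lt e
    ...   | inj₂ refl = inj₁ (degree-inner {v} [] (noChild-kids (last-external {v} e))
                              (subst (1 ≤_) (sym e) (spine-pos {suc t} (s≤s z≤n))))

  binary : IsBinaryTree G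
  binary = rooted-isTree , λ v ¬1 → [ (λ d → ⊥-elim (¬1 d)) , id ]′ (degrees v)

  private
    spine-up : ∀ t {x} → toℕ x ≡ spine (suc t) → Σ[ y ∈ Fin n ] IsPar y x × toℕ y ≡ spine t
    spine-up t {x} e = parentOf x 1≤x , p , trans (proj₂ p) (trans (cong caterpillarParent e) (spine-parent t))
      where
      1≤x : 1 ≤ toℕ x
      1≤x = subst (1 ≤_) (sym e) (spine-pos {suc t} (s≤s z≤n))
      p = parentOf-isPar x 1≤x

    SpinePath : Fin n → ℕ → Set
    SpinePath x t = ∃[ k ] Σ[ p ∈ Walk G x root k ] IsPath p × All (λ y → toℕ y ≤ spine t) (vertices p) ×
                    (∀ y j → j ≤ t → toℕ y ≡ spine j → y ∈ vertices p)

    spine-path : ∀ t {x} → toℕ x ≡ spine t → SpinePath x t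
    spine-path zero {x} e with Fin.toℕ-injective {j = root} e
    ... | refl = 0 , [ root ] , [] ∷ [] , z≤n ∷ [] , λ { y zero _ e′ → here (Fin.toℕ-injective e′) }
    spine-path (suc t) {x} e = extend (spine-up t e)
      where
      extend : (Σ[ x′ ∈ Fin n ] IsPar x′ x × toℕ x′ ≡ spine t) → SpinePath x (suc t)
      extend (x′ , p , e′) = let k , q , iq , low , has = spine-path t e′ in
        suc k , Adj⁺ʳ p ∷ q ,
        All.map (λ {y} le → above (subst₂ _<_ e′ e (IsPar-< p)) le) low ∷ iq ,
        ≤-reflexive e ∷ All.map (λ le → ≤-trans le (spine-mono (n≤1+n t))) low ,
        has′ has
        where
        above : ∀ {y} → spine t < spine (suc t) → toℕ y ≤ spine t → x ≢ y
        above lt le refl = <⇒≱ lt (≤-trans (≤-reflexive (sym e)) le)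
        has′ : ∀ {ys} → (∀ y j → j ≤ t → toℕ y ≡ spine j → y ∈ ys) →
               ∀ y j → j ≤ suc t → toℕ y ≡ spine j → y ∈ (x ∷ ys)
        has′ has y j j≤ ey with m≤n⇒m<n∨m≡n j≤
        ... | inj₁ lt = there (has y j (s≤s⁻¹ lt) ey)
        ... | inj₂ refl = here (Fin.toℕ-injective (trans ey (sym e)))

  caterpillar : IsBinaryCaterpillar G
  caterpillar with spine-path (suc s) (toℕ-spineVertex (suc s) ≤-refl)
  ... | k , p , ip , _ , has = binary , _ , _ , k , p , ip , near
    where
    near : ∀ x → x ∉ vertices p → ∃[ y ] y ∈ vertices p × Adj G x y
    near x x∉ with view x
    ... | onSpine t le e = ⊥-elim (x∉ (has x t le e))
    ... | leg t 1≤t t≤s e = parentOf x 1≤x , has _ t (≤-trans t≤s (n≤1+n s))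
          (trans (proj₂ q) (trans (cong caterpillarParent e) (cong spine (half-double t)))) , Adj⁺ʳ q
      where
      1≤x : 1 ≤ toℕ x
      1≤x = subst (1 ≤_) (sym e) (≤-trans 1≤t (m≤m+n t t))
      q = parentOf-isPar x 1≤x

  private
    spine-dist : ∀ k i {x y} → toℕ x ≡ spine (k + i) → toℕ y ≡ spine i → dist x y ≤ k
    spine-dist zero i {x} {y} ex ey with Fin.toℕ-injective (trans ex (sym ey))
    ... | refl = ≤-reflexive (dist-refl x)
    spine-dist (suc k) i {x} {y} ex ey = let x′ , p , e′ = spine-up (k + i) ex in
      ≤-trans (dist-adj y (Adj⁺ʳ p)) (s≤s (spine-dist k i e′ ey))

    spine-dist′ : ∀ {i j x y} → i ≤ j → toℕ x ≡ spine j → toℕ y ≡ spine i → dist x y ≤ j ∸ i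
    spine-dist′ {i} {j} i≤j ex = spine-dist (j ∸ i) i (trans ex (cong spine (sym (m∸n+n≡m i≤j))))

    -- A leg is an excursion of length 1 from the spine. The two inequalities on `ℓ` say that it
    -- reaches no farther than either end of the spine does, so it can be replaced by a spine vertex
    -- in upper bounds for distances.
    record Located (x : Fin n) : Set where
      constructor located
      field
        {t ℓ} : ℕ
        {z} : Fin n
        z≡ : toℕ z ≡ spine t
        near : dist x z ≤ ℓ
        ℓ≤t : ℓ ≤ t
        t+ℓ≤ : t + ℓ ≤ suc s

    locate : ∀ x → Located x
    locate x with view x
    ... | onSpine t le e = located {t = t} {0} e (≤-reflexive (dist-refl x)) z≤n (≤-trans (≤-reflexive (+-identityʳ t)) le)
    ... | leg t 1≤t t≤s e = located {t = t} {1} (trans (proj₂ q) (trans (cong caterpillarParent e) (cong spine (half-double t))))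
            (≤-reflexive (adj-dist (Adj⁺ʳ q))) 1≤t (≤-trans (≤-reflexive (+-comm t 1)) (s≤s t≤s))
      where q = parentOf-isPar x (subst (1 ≤_) (sym e) (≤-trans 1≤t (m≤m+n t t)))

    via : ∀ {x y z z′ ℓ ℓ′ k} → dist x z ≤ ℓ → dist z z′ ≤ k → dist y z′ ≤ ℓ′ → dist x y ≤ ℓ + k + ℓ′
    via {x} {y} {z} {z′} p q r = ≤-trans (dist-triangle x z′ y)
      (+-mono-≤ (≤-trans (dist-triangle x z z′) (+-mono-≤ p q)) (≤-trans (≤-reflexive (dist-sym z′ y)) r))

    arith-diam : ∀ {ℓ ℓ′ t t′ N} → ℓ ≤ t → t ≤ t′ → t′ + ℓ′ ≤ N → ℓ + (t′ ∸ t) + ℓ′ ≤ N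
    arith-diam {ℓ} {ℓ′} {t} {t′} p q r = ≤-trans (+-monoˡ-≤ ℓ′ (≤-trans (+-monoˡ-≤ (t′ ∸ t) p) (≤-reflexive (m+[n∸m]≡n q)))) r

  dist≤ : ∀ x y → dist x y ≤ suc s
  dist≤ x y with locate x | locate y
  ... | located {t} {ℓ} z≡ p ℓ≤t t+ℓ | located {t′} {ℓ′} z′≡ p′ ℓ≤t′ t+ℓ′ with ≤-total t t′
  ...   | inj₁ le = ≤-trans (via p (≤-trans (≤-reflexive (dist-sym _ _)) (spine-dist′ le z′≡ z≡)) p′) (arith-diam ℓ≤t le t+ℓ′)
  ...   | inj₂ le = ≤-trans (≤-reflexive (dist-sym x y))
            (≤-trans (via p′ (≤-trans (≤-reflexive (dist-sym _ _)) (spine-dist′ le z≡ z′≡)) p) (arith-diam ℓ≤t′ le t+ℓ))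

  -- A vertex located before position `D` is within `D` of `y`, and `D + D ≤ suc s` leaves room for
  -- another `D`; a vertex located later is no farther from `y` than the end of the spine.
  dist-spine≤ : ∀ {D y} → D + D ≤ suc s → toℕ y ≡ spine D → ∀ x → dist x y + D ≤ suc s
  dist-spine≤ {D} {y} D≤ y≡ x with locate x
  ... | located {t} {ℓ} z≡ p ℓ≤t t+ℓ with ≤-total t D
  ...   | inj₁ le = ≤-trans (+-monoˡ-≤ D (≤-trans
              (via p (≤-trans (≤-reflexive (dist-sym _ _)) (spine-dist′ le y≡ z≡)) (≤-reflexive (dist-refl y)))
              (arith-diam ℓ≤t le (≤-reflexive (+-identityʳ D))))) D≤
  ...   | inj₂ le = ≤-trans (+-monoˡ-≤ D (via p (spine-dist′ le z≡ y≡) (≤-reflexive (dist-refl y))))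
            (≤-trans (≤-reflexive rearrange) t+ℓ)
      where
      regroup : ∀ ℓ k D → ℓ + k + 0 + D ≡ k + D + ℓ
      regroup ℓ k D = solve (ℓ ∷ᵛ k ∷ᵛ D ∷ᵛ [])
      rearrange : ℓ + (t ∸ D) + 0 + D ≡ t + ℓ
      rearrange = trans (regroup ℓ (t ∸ D) D) (cong (_+ ℓ) (m∸n+n≡m le))

  end : Fin n
  end = spineVertex (suc s) ≤-refl

  dist-end : dist end root ≡ suc s
  dist-end = trans (dist-root end) (trans (cong depth (toℕ-spineVertex (suc s) ≤-refl)) (spine-depth (suc s)))

  open CC G rooted-isTree 2≤n

  root-maxEccentric : MaxEccentric G root
  root-maxEccentric = MaxEccentric⁺ λ w → ≤-trans (dist≤ _ w)
    (≤-trans (≤-reflexive (sym dist-end)) (dist≤ecc end root))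

-- The extremal crg tree.

mapʷ : ∀ {m n} {G : Graph m} {H : Graph n} (f : Fin m → Fin n) → (∀ {u v} → Adj G u v → Adj H (f u) (f v)) →
       ∀ {u v k} → Walk G u v k → Walk H (f u) (f v) k
mapʷ f adj [ v ] = [ f v ]
mapʷ {G = G} {H} f adj (a ∷ p) = adj a ∷ mapʷ {G = G} {H} f adj p

-- The caterpillar has `2e` vertices for `e = suc s`, and `s < a` says `e ≤ a`: the heap, with
-- `2a + 1` vertices, outweighs the `2e − 1` vertices outside it.
module Extremal (a s : ℕ) (s<a : s < a) where

  private
    module A where
      open HeapDepth public
      open Rooted (a + a) public
    module B where
      open CaterpillarDepth public
      open Rooted (suc (s + s)) public
      open Caterpillar s public

  open Gluing heapParent caterpillarParent heapParent< caterpillarParent< (a + a)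

  private
    N : ℕ
    N = suc (s + s)

    module GP = Parent pT pT<

  open GP
  open Rooted (a + a + N)

  n : ℕ
  n = suc (a + a + N)

  2≤n : 2 ≤ n
  2≤n = s≤s (≤-trans (s≤s z≤n) (m≤n+m N (a + a)))

  T* : Graph n
  T* = G

  open Branch G rooted-isTree
  open CC G rooted-isTree 2≤n

  private
    1≤a : 1 ≤ a
    1≤a = ≤-trans (s≤s z≤n) s<a

    fᴴ : Fin (suc (a + a)) → Fin n
    fᴴ = f N

    gᶜ : Fin (suc N) → Fin n
    gᶜ = g N

    -- An inclusion maps walks to walks, so upper bounds for distances pass from the two pieces to
    -- the glued tree. Lower bounds come from depths and from `crossing`.
    f-dist : ∀ x y → dist (fᴴ x) (fᴴ y) ≤ A.dist x y
    f-dist x y = dist-min (mapʷ {G = A.G} {G} fᴴ (λ e → [ Adj⁺ ∘ f-isPar N , Adj⁺ʳ ∘ f-isPar N ]′ (A.Adj⁻ e)) (A.dist-walk x y))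

    g-dist : ∀ x y → dist (gᶜ x) (gᶜ y) ≤ B.dist x y
    g-dist x y = dist-min (mapʷ {G = B.G} {G} gᶜ (λ e → [ Adj⁺ ∘ g-isPar N , Adj⁺ʳ ∘ g-isPar N ]′ (B.Adj⁻ e)) (B.dist-walk x y))

    depth-shift : ∀ j → depth (shift j) ≡ CaterpillarDepth.depth j
    depth-shift j = go j (<-wellFounded j)
      where
      go : ∀ j → Acc _<_ j → depth (shift j) ≡ CaterpillarDepth.depth j
      go zero _ = refl
      go j@(suc _) (acc rs) = trans (depth-par {shift j} (≤-trans (s≤s z≤n) (shift-pos {j} (s≤s z≤n))))
        (trans (cong suc (trans (cong depth (pT-B {j} (s≤s z≤n))) (go (caterpillarParent j) (rs (caterpillarParent< {j} (s≤s z≤n))))))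
          (sym (CaterpillarDepth.depth-par {j} (s≤s z≤n))))

    g-height : ∀ j → dist (gᶜ j) root ≡ CaterpillarDepth.depth (toℕ j)
    g-height j = trans (dist-root (gᶜ j)) (trans (cong depth (toℕ-g N j)) (depth-shift (toℕ j)))

    f-root : fᴴ zero ≡ root
    f-root = Fin.toℕ-injective (toℕ-f N zero)

    heap-dist : ∀ {x} → toℕ x ≤ a + a → dist x root ≤ HeapDepth.depth (a + a)
    heap-dist {x} le with f-hit N {x} le
    ... | i , refl = ≤-trans (subst (λ r → dist (fᴴ i) r ≤ A.dist i zero) f-root (f-dist i zero))
                       (≤-trans (≤-reflexive (A.dist-root i)) (heap-depth-mono (s≤s⁻¹ (Fin.toℕ<n i))))

    -- The root is pendant in the caterpillar, so the edge from the root to this vertex separates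
    -- the heap from everything else.
    u : Fin n
    u = gᶜ (suc zero)

    toℕ-u : toℕ u ≡ a + a + 1
    toℕ-u = toℕ-g N (suc zero)

    root-u : Adj G root u
    root-u = subst (λ r → Adj G r u) (Fin.toℕ-injective (toℕ-g N zero))
               (Adj⁺ (g-isPar N {zero} {suc zero} (s≤s z≤n , refl)))

    u-root : Adj G u root
    u-root = Adj-sym {G = G} root-u

    u-outside : a + a < toℕ u
    u-outside = ≤-reflexive (trans (+-comm 1 (a + a)) (sym toℕ-u))

    heap-side : ∀ x → toℕ x ≤ a + a → Side root u x
    heap-side x = go x (<-wellFounded (toℕ x))
      where
      go : ∀ x → Acc _<_ (toℕ x) → toℕ x ≤ a + a → Side root u x
      go zero _ _ = side-self root-u
      go x@(suc _) (acc rs) le = decide (side-split x root-u)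
        where
        p = parentOf-isPar x (s≤s z≤n)
        IH : Side root u (parentOf x (s≤s z≤n))
        IH = go _ (rs (IsPar-< p)) (≤-trans (<⇒≤ (IsPar-< p)) le)
        decide : Side root u x ⊎ Side u root x → Side root u x
        decide (inj₁ r) = r
        decide (inj₂ r) = ⊥-elim (<⇒≱ u-outside (subst (λ z → toℕ z ≤ a + a) (proj₂ (cross-edge root-u (Adj⁺ p) IH r)) le))

    outside-side : ∀ x → a + a < toℕ x → Side u root x
    outside-side x = go x (<-wellFounded (toℕ x))
      where
      go : ∀ x → Acc _<_ (toℕ x) → a + a < toℕ x → Side u root x
      go x (acc rs) lt with toℕ x ≤? suc (a + a)
      ... | yes le = subst (Side u root) (Fin.toℕ-injective (trans toℕ-u (trans (+-comm (a + a) 1) (≤-antisym lt le))))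
                       (side-self u-root)
      ... | no ≰ = decide (side-split x root-u)
        where
        1≤x : 1 ≤ toℕ x
        1≤x = ≤-trans (s≤s z≤n) lt
        p = parentOf-isPar x 1≤x
        j : ℕ
        j = toℕ x ∸ (a + a)
        2≤j : 2 ≤ j
        2≤j = m+n≤o⇒m≤o∸n 2 (≰⇒> ≰)
        parent-outside : a + a < toℕ (parentOf x 1≤x)
        parent-outside = subst (a + a <_)
          (sym (trans (proj₂ p) (trans (cong pT (sym (shift-∸ lt))) (pT-B {j} (≤-trans (s≤s z≤n) 2≤j)))))
          (shift-pos (spine-pos (⌊n/2⌋-mono 2≤j)))
        IH : Side u root (parentOf x 1≤x)
        IH = go _ (rs (IsPar-< p)) parent-outside
        decide : Side root u x ⊎ Side u root x → Side u root x
        decide (inj₂ r) = r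
        decide (inj₁ r) = ⊥-elim (n≮0 (subst (λ z → a + a < toℕ z) (proj₂ (cross-edge u-root (Adj⁺ p) IH r)) lt))

    size-heap : size root u ≡ suc (a + a)
    size-heap = trans (count-⇔ {g = λ x → toℕ x <ᵇ suc (a + a)} to from)
                      (count-below (suc (a + a)) (s≤s (m≤m+n (a + a) N)))
      where
      to : ∀ x → T (side root u x) → T (toℕ x <ᵇ suc (a + a))
      to x t with toℕ x ≤? a + a
      ... | yes le = <⇒<ᵇ (s≤s le)
      ... | no ≰ = ⊥-elim (<-asym (side⁻ {root} {u} t) (outside-side x (≰⇒> ≰)))
      from : ∀ x → T (toℕ x <ᵇ suc (a + a)) → T (side root u x)
      from x t = side⁺ (heap-side x (s≤s⁻¹ (<ᵇ⇒< (toℕ x) _ t)))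

    size-caterpillar : size u root ≤ a + a
    size-caterpillar = ≤-trans (≤-reflexive (+-cancelˡ-≡ (suc (a + a)) _ _
        (trans (cong (_+ size u root) (sym size-heap)) (size-sum root-u))))
      (≤-trans (s≤s (+-monoʳ-≤ s (n≤1+n s))) (+-mono-≤ s<a s<a))

    -- The side of `u` is small because `s < a`, and the side of any other neighbour lies in the
    -- heap and misses the root.
    weight-root : weight root ≤ a + a
    weight-root = let w , rw , eq = weight-attained root in
      ≤-trans (≤-reflexive eq) (small rw (w ≟ u))
      where
      small : ∀ {w} → Adj G root w → Dec (w ≡ u) → size w root ≤ a + a
      small rw (yes refl) = size-caterpillar
      small {w} rw (no w≢u) = s≤s⁻¹ (≤-trans (≤-reflexive (+-comm 1 _))
        (≤-trans (+-monoʳ-≤ (size w root) (≤-reflexive (sym (count-single root))))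
          (≤-trans (count-disjoint {f = side root u} {side w root} {λ x → ⌊ x ≟ root ⌋}
              (λ x t → side⁺ (side-extend root-u rw w≢u (side⁻ t)))
              (λ x t → side⁺ (subst (Side root u) (sym (toWitness t)) (side-self root-u)))
              (λ x t t′ → <-asym (subst (Side w root) (toWitness t′) (side⁻ t)) (side-self rw)))
            (≤-reflexive size-heap))))

    -- The branch at `y` towards the root contains the whole heap, so `y` is heavier than the root
    -- and cannot be a centroid vertex.
    weight-outside : ∀ y → a + a < toℕ y → a + a < weight y
    weight-outside y lt = go (dist y root) refl
      where
      uy : dist root y ≡ suc (dist u y)
      uy = side-dist u-root (outside-side y lt)
      go : ∀ k → dist y root ≡ k → a + a < weight y
      go zero e = ⊥-elim (n≮0 (subst (λ z → a + a < toℕ z) (dist-0 e) lt))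
      go (suc k) e with closer e
      ... | w , yw , e′ = ≤-trans (≤-reflexive (sym size-heap))
        (≤-trans (count-mono {f = side root u} λ x t → side⁺ (nearer x (side⁻ t))) (size≤weight yw))
        where
        k≡ : k ≡ dist u y
        k≡ = suc-injective (trans (sym e) (trans (dist-sym y root) uy))
        nearer : ∀ x → Side root u x → Side w y x
        nearer x sx = ≤-trans (s≤s (≤-trans (dist-triangle w root x)
            (≤-trans (≤-reflexive (cong₂ _+_ (trans e′ k≡) (dist-sym root x))) (≤-reflexive (+-comm (dist u y) (dist x root))))))
          (≤-trans (≤-reflexive (sym (+-suc _ _)))
            (≤-trans (crossing root-u sx (outside-side y lt)) (≤-reflexive (dist-sym x y))))

    centroid-in-heap : ∀ {y} → Centroid G y → toℕ y ≤ a + a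
    centroid-in-heap {y} isC with toℕ y ≤? a + a
    ... | yes le = le
    ... | no ≰ = ⊥-elim (<⇒≱ (weight-outside y (≰⇒> ≰)) (≤-trans (Centroid⁻ isC root) weight-root))

    far-end : Fin n
    far-end = gᶜ B.end

    end-height : dist far-end root ≡ suc s
    end-height = trans (g-height B.end) (trans (sym (B.dist-root B.end)) B.dist-end)

    end-outside : a + a < toℕ far-end
    end-outside = subst (a + a <_) (sym (toℕ-g N B.end))
      (shift-pos (subst (1 ≤_) (sym (B.toℕ-spineVertex (suc s) ≤-refl)) (spine-pos {suc s} (s≤s z≤n))))

    -- For the spine vertex at depth `D`, heap vertices are within `H + D`, which by hypothesis
    -- leaves room for another `D`; the caterpillar vertices are covered by `dist-spine≤`.
    spine-ecc : ∀ {D} → D + D + HeapDepth.depth (a + a) ≤ suc s → ∃[ z ] ecc z + D ≤ suc s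
    spine-ecc {D} le = z , subst (λ k → k + D ≤ suc s) (sym (proj₂ (ecc-attained z))) (bound (proj₁ (ecc-attained z)))
      where
      D+D≤ : D + D ≤ suc s
      D+D≤ = ≤-trans (m≤m+n (D + D) _) le
      D≤ : D ≤ suc s
      D≤ = ≤-trans (m≤m+n D D) D+D≤
      y = B.spineVertex D D≤
      z : Fin n
      z = gᶜ y
      z-height : dist z root ≡ D
      z-height = trans (g-height y) (trans (cong CaterpillarDepth.depth (B.toℕ-spineVertex D D≤)) (spine-depth D))
      through : ∀ {x H} → x ≤ H → D + D + H ≤ suc s → x + D + D ≤ suc s
      through {x} {H} p q = ≤-trans (≤-trans (≤-reflexive (regroup x)) (+-monoʳ-≤ (D + D) p)) q
        where
        regroup : ∀ x → x + D + D ≡ D + D + x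
        regroup x = solve (x ∷ᵛ D ∷ᵛ [])
      bound : ∀ x → dist x z + D ≤ suc s
      bound x with toℕ x ≤? a + a
      ... | yes x≤ = ≤-trans (+-monoˡ-≤ D (≤-trans (dist-triangle x root z)
                       (+-monoʳ-≤ _ (≤-reflexive (trans (dist-sym root z) z-height))))) (through (heap-dist x≤) le)
      ... | no ≰ with g-hit N {x} (toℕ x ∸ (a + a))
                        (s≤s (≤-trans (∸-monoˡ-≤ (a + a) (s≤s⁻¹ (Fin.toℕ<n x))) (≤-reflexive (m+n∸m≡n (a + a) N))))
                        (shift-∸ (≰⇒> ≰))
      ...   | j , refl , _ = ≤-trans (+-monoˡ-≤ D (g-dist j y)) (B.dist-spine≤ D+D≤ (B.toℕ-spineVertex D D≤) j)

  -- A center `x` has `ecc x + D ≤ suc s`, whereas the far end of the spine has height `suc s`. If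
  -- `x` is in the heap, then `suc s ≤ ecc x` and `D` is 0. Otherwise `suc s ≤ ecc x + dist x root`
  -- gives `x` height at least `D`, and its path to a centroid vertex in the heap passes through the
  -- root.
  centerCentroid-≥ : ∀ {D d} → D + D + HeapDepth.depth (a + a) ≤ suc s → IsCenterCentroidDist G d → D ≤ d
  centerCentroid-≥ {D} {d} le ((x , y , isC , isW , isD) , _) with spine-ecc {D} le
  ... | z , ecc-z with toℕ x ≤? a + a
  ...   | yes x≤ = ≤-trans (+-cancelˡ-≤ (suc s) D 0 (≤-trans (+-monoˡ-≤ D far) (≤-trans ecc-x (≤-reflexive (sym (+-identityʳ _)))))) z≤n
    where
    ecc-x : ecc x + D ≤ suc s
    ecc-x = ≤-trans (+-monoˡ-≤ D (Center⁻ isC z)) ecc-z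
    far : suc s ≤ ecc x
    far = ≤-trans (≤-reflexive (trans (sym end-height) (trans (dist-sym far-end root) (side-dist u-root (outside-side far-end end-outside)))))
      (≤-trans (m≤n+m _ (dist x root)) (≤-trans (crossing root-u (heap-side x x≤) (outside-side far-end end-outside))
        (≤-trans (≤-reflexive (dist-sym x far-end)) (dist≤ecc far-end x))))
  ...   | no ≰ = ≤-trans (+-cancelˡ-≤ (ecc x) D _ (≤-trans (≤-trans (+-monoˡ-≤ D (Center⁻ isC z)) ecc-z) far)) near
    where
    far : suc s ≤ ecc x + dist x root
    far = ≤-trans (≤-reflexive (sym end-height)) (≤-trans (dist-triangle far-end x root) (+-monoˡ-≤ _ (dist≤ecc far-end x)))
    near : dist x root ≤ d
    near = ≤-trans (≤-reflexive (trans (dist-sym x root) (side-dist u-root (outside-side x (≰⇒> ≰)))))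
      (≤-trans (m≤n+m _ (dist y root)) (≤-trans (crossing root-u (heap-side y (centroid-in-heap isW)) (outside-side x (≰⇒> ≰)))
        (≤-reflexive (trans (dist-sym y x) (sym (dist-unique isD))))))

  isCrg : IsCrg n (suc (a + a)) T*
  isCrg = (divides (a + suc s) (evenness a s) , 4≤n) ,
    ((λ { (divides q e) → even≢odd q a (trans (*-comm 2 q) (trans (sym e) (cong suc (cong (a +_) (sym (+-identityʳ a)))))) }) ,
     s≤s (+-mono-≤ 1≤a 1≤a) , s≤s (≤-trans (≤-reflexive (+-comm 1 (a + a))) (+-monoʳ-≤ (a + a) (s≤s z≤n)))) ,
    A.G , A.root , subst Glued (sym order) (B.G , B.root , Heap.heap-rgood a 1≤a , B.caterpillar , B.root-maxEccentric , identification N)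
    where
    evenness : ∀ a s → suc (a + a + suc (s + s)) ≡ (a + suc s) * 2
    evenness a s = solve (a ∷ᵛ s ∷ᵛ [])
    4≤n : 4 ≤ n
    4≤n = s≤s (+-mono-≤ (+-mono-≤ 1≤a 1≤a) (s≤s z≤n))
    Glued : ℕ → Set₁
    Glued k = Σ[ C ∈ Graph k ] Σ[ c ∈ Fin k ]
      IsRgood A.G A.root × IsBinaryCaterpillar C × MaxEccentric C c × IsIdentification A.G A.root C c T*
    order : n ∸ suc (a + a) + 1 ≡ suc N
    order = trans (cong (_+ 1) (m+n∸m≡n (a + a) N)) (+-comm N 1)

  opaque
    crg-centerCentroidDist : Σ[ T ∈ Graph n ] (∃[ l ] IsCrg n l T) × ∃[ d ] IsCenterCentroidDist T d ×
                             (∀ {D} → D + D + HeapDepth.depth (a + a) ≤ suc s → D ≤ d)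
    crg-centerCentroidDist = T* , (_ , isCrg) , proj₁ cc , proj₂ cc , λ le → centerCentroid-≥ le (proj₂ cc)
      where
      cc : ∃ (IsCenterCentroidDist T*)
      cc = centerCentroidDist

-- Comparison of the two bounds.

half-≤ : ∀ {x y} → 2 * x ≤ suc (y + y) → x ≤ y
half-≤ {x} {y} p = ≮⇒≥ λ y<x → n≮0 (contra (+-mono-≤ p (+-mono-≤ y<x y<x)))
  where
  contra : 2 * x + (suc y + suc y) ≤ suc (y + y) + (x + x) → 1 ≤ 0
  contra q = lin 0 q (solve (x ∷ᵛ y ∷ᵛ []))

⌈n/2⌉≤1+⌊n/2⌋ : ∀ n → ⌈ n /2⌉ ≤ suc ⌊ n /2⌋
⌈n/2⌉≤1+⌊n/2⌋ zero = z≤n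
⌈n/2⌉≤1+⌊n/2⌋ (suc zero) = s≤s z≤n
⌈n/2⌉≤1+⌊n/2⌋ (suc (suc n)) = s≤s (⌈n/2⌉≤1+⌊n/2⌋ n)

-- With `e = suc s`, the larger side satisfies `A ≥ a + e + 1 ≥ 2a`. Thus `H > h` would give
-- `2 ^ h ≤ a` and `A < 2a`, which is impossible. On the smaller side `B + 1 ≤ a + e ≤ 2e + 1`, and
-- halving rounds this down to `2d + h ≤ e`.
distance-arithmetic : ∀ {a s A B d h H} → a ≤ suc (suc s) → A + B ≡ suc (a + a + suc (s + s)) → B < A →
  A < 2 ^ suc h → 2 * (d + d + h) ≤ suc B → 2 ^ H ≤ suc (a + a) → d + d + H ≤ suc s
distance-arithmetic {a} {s} {A} {B} {d} {h} {H} a≤ A+B B<A A< far H-bound =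
  ≤-trans (+-monoʳ-≤ (d + d) H≤h) (half-≤ (≤-trans far (≤-trans 1+B≤ below)))
  where
  1+B≤ : suc B ≤ a + suc s
  1+B≤ = ≰⇒> λ le → n≮0 (contra (+-mono-≤ (+-mono-≤ le le) (+-mono-≤ B<A (≤-reflexive A+B))))
    where
    contra : a + suc s + (a + suc s) + (suc B + (A + B)) ≤ B + B + (A + suc (a + a + suc (s + s))) → 1 ≤ 0
    contra q = lin 0 q (solve (a ∷ᵛ s ∷ᵛ A ∷ᵛ B ∷ᵛ []))
  below : a + suc s ≤ suc (suc s + suc s)
  below = +-monoˡ-≤ (suc s) a≤
  H≤h : H ≤ h
  H≤h = ≮⇒≥ λ h<H → n≮0 (contra (2 ^ h) (half-≤ (≤-trans (^-monoʳ-≤ 2 h<H) H-bound)) A<)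
    where
    contra : ∀ P → P ≤ a → A < 2 * P → 1 ≤ 0
    -- Taken 4, 2, 1, 1 and 2 times, the five facts add up so that every variable cancels and
    -- `5 ≤ 4` remains.
    contra P P≤a A<P = total (+-mono-≤ (+-mono-≤ (+-mono-≤ (+-mono-≤ P≤a P≤a) (+-mono-≤ P≤a P≤a)) (+-mono-≤ A<P A<P))
                              (+-mono-≤ (+-mono-≤ B<A (≤-reflexive (sym A+B))) (+-mono-≤ a≤ a≤)))
      where
      total : P + P + (P + P) + (suc A + suc A) + (suc B + suc (a + a + suc (s + s)) + (a + a)) ≤
            a + a + (a + a) + (2 * P + 2 * P) + (A + (A + B) + (suc (suc s) + suc (suc s))) → 1 ≤ 0
      total q = lin 0 q (solve (P ∷ᵛ a ∷ᵛ s ∷ᵛ A ∷ᵛ B ∷ᵛ []))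

MaximizedByCrg : ℕ → Set₁
MaximizedByCrg n = Σ[ T* ∈ Graph n ] (∃[ l ] IsCrg n l T*) ×
  (∃[ d* ] IsCenterCentroidDist T* d* ×
    (∀ (T : Graph n) → IsBinaryTree T → ∃[ d ] IsCenterCentroidDist T d × d ≤ d*))

maximizedByCrg : ∀ a s → s < a → a ≤ suc (suc s) → MaximizedByCrg (suc (a + a + suc (s + s)))
maximizedByCrg a s s<a a≤ = let T* , crg , d* , isD* , d*≥ = Extremal.crg-centerCentroidDist a s s<a in
  T* , crg , d* , isD* , optimal d*≥
  where
  n = suc (a + a + suc (s + s))
  optimal : ∀ {d*} → (∀ {D} → D + D + HeapDepth.depth (a + a) ≤ suc s → D ≤ d*) →
            (T : Graph n) → IsBinaryTree T → ∃[ d ] IsCenterCentroidDist T d × d ≤ d*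
  optimal {d*} d*≥ T binary = bound (CC.centerCentroidDist T (proj₁ binary) 2≤n)
    where
    2≤n : 2 ≤ n
    2≤n = s≤s (≤-trans (s≤s z≤n) (m≤n+m (suc (s + s)) (a + a)))
    bound : ∃ (IsCenterCentroidDist T) → ∃[ d ] IsCenterCentroidDist T d × d ≤ d*
    bound (zero , isD) = zero , isD , z≤n
    bound (suc k , isD) = let h , A , B , A+B , B<A , A< , far = BinaryTree.centerCentroid-bound T binary 2≤n isD in
      suc k , isD , d*≥ (distance-arithmetic {d = suc k} {h} a≤ A+B B<A A< far (heap-depth-bound (a + a)))

theorem3p1 : ∀ n → 2 ∣ n → 12 ≤ n →
    Σ[ T* ∈ Graph n ] (∃[ l ] IsCrg n l T*) ×
    (∃[ d* ] IsCenterCentroidDist T* d* ×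
    (∀ (T : Graph n) → IsBinaryTree T →
    ∃[ d ] IsCenterCentroidDist T d × d ≤ d*))
theorem3p1 n (divides m n≡) 12≤n =
  -- Half of `n` is divided as evenly as possible into `a` and `e`, with the larger part for the
  -- heap; `1 ≤ e` allows `e` to be written as `suc s`.
  split ⌈ m /2⌉ ⌊ m /2⌋ (⌊n/2⌋≤⌈n/2⌉ m) (⌈n/2⌉≤1+⌊n/2⌋ m) (⌊n/2⌋-mono (≤-trans (s≤s (s≤s z≤n)) 6≤m))
    (trans (cong (_* 2) (trans (+-comm ⌈ m /2⌉ _) (⌊n/2⌋+⌈n/2⌉≡n m))) (sym n≡))
  where
  6≤m : 6 ≤ m
  6≤m = *-cancelʳ-≤ 6 m 2 (subst (12 ≤_) n≡ 12≤n)
  order : ∀ a s → suc (a + a + suc (s + s)) ≡ (a + suc s) * 2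
  order a s = solve (a ∷ᵛ s ∷ᵛ [])
  split : ∀ a e → e ≤ a → a ≤ suc e → 1 ≤ e → (a + e) * 2 ≡ n → MaximizedByCrg n
  split a (suc s) s<a a≤ _ eq = subst MaximizedByCrg (trans (order a s) eq) (maximizedByCrg a s s<a a≤)
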